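{- Assume the Parity Conjecture. Let $f(x)\in\mathbf{Z}[x]$ be a separable polynomial of degree 4 having a rational root, and let $p$ be a good prime for $f(x)$. Then for every integer $m$ coprime to $p$ there exist infinitely many elements $d\in\mathcal{S}(f)$ such that $d\equiv m\pmod p$.
   Context: Squarefree integers may be negative and are nonzero. For a nonzero rational number $r$, its squarefree part $S(r)$ is the unique squarefree integer $d$ such that $r/d$ is a square in $\mathbf{Q}$. For a separable nonconstant $f(x)\in\mathbf{Z}[x]$, $\mathcal{S}(f)=\{S(f(r)) : r\in\mathbf{Q},\ f(r)\neq 0\}$. An odd prime $p$ is good for $f(x)$ if the reduced polynomial $\bar f(x)\in\mathbf{F}_p[x]$ has the same degree as $f(x)$ and has nonzero discriminant. For an elliptic curve $E: y^2=g(x)$ over $\mathbf{Q}$ and a squarefree integer $d$, $E_d: dy^2=g(x)$ denotes the quadratic twist of $E$ by $d$. The Parity Conjecture is used in the following form, for quadratic twists: Let $E$ be an elliptic curve over $\mathbf{Q}$ with conductor $N_E$, and let $d$ be a squarefree integer coprime to $2N_E$. Then $(-1)^{\operatorname{rank} E_d(\mathbf{Q})}=(-1)^{\operatorname{rank} E(\mathbf{Q})}\cdot\chi_d(-N_E)$, where $\chi_d$ is the quadratic Dirichlet character associated to the field $\mathbf{Q}(\sqrt d)$. Here, if $D$ is the discriminant of $\mathbf{Q}(\sqrt d)$, $\chi_d$ is given by the Kronecker symbol $\chi_d(n)=\left(\frac{D}{n}\right)$. -}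

module Defs where

open import Algebra.Bundles using (RawMonoid)
import Algebra.Definitions.RawMonoid as RawMonoidDefs
open import Data.Bool.Base using (Bool; _∧_; if_then_else_)
open import Data.Bool.ListAction using (any)
open import Data.Fin.Base using (Fin; toℕ; splitAt; punchIn)
open import Data.Integer.Base as ℤ
  using (ℤ; +_; -[1+_]; ∣_∣; 0ℤ; 1ℤ; -1ℤ)
import Data.Integer.Coprimality as ℤ
import Data.Integer.Divisibility as ℤ
open import Data.List.Base as List
  using (List; []; _∷_; _++_; replicate; upTo; findᵇ; foldr; deduplicate; cartesianProduct)
open import Data.List.Membership.Propositional using (_∉_)
open import Data.Maybe.Base using (Maybe; just; nothing; fromMaybe)
open import Data.Nat.Base as ℕ using (ℕ; zero; suc)
open import Data.Nat.Divisibility using (_∣?_)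
open import Data.Nat.ListAction using (product)
open import Data.Nat.Primality using (Prime)
open import Data.Nat.Primality.Factorisation using (factorise; module PrimeFactorisation)
import Data.Nat.Properties as ℕ
open import Data.Product.Base using (_×_; _,_; ∃; ∃₂)
open import Data.Rational.Base as ℚ using (ℚ; 0ℚ; 1ℚ; ↥_; ↧ₙ_)
open import Data.Rational.Literals using (fromℤ)
import Data.Rational.Properties as ℚ
open import Data.Sum.Base using ([_,_]′)
open import Data.Unit.Base using (⊤)
open import Data.Vec.Base using (Vec; last; reverse; toList; tabulate; lookup; tail)
import Data.Vec.Functional as Vector
open import Level using (0ℓ)
open import Relation.Binary.PropositionalEquality.Core using (_≡_; _≢_)
open import Relation.Nullary.Decidable.Core using (yes; no; does)
open import Relation.Nullary.Negation.Core using (¬_)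
open import Relation.Unary using (Pred)

-- 0 is not squarefree, since 2 * 2 divides it.
Squarefree : Pred ℤ 0ℓ
Squarefree d = ∀ n → + (n ℕ.* n) ℤ.∣ d → n ≡ 1

infix 4 _≡_[mod_]
_≡_[mod_] : ℤ → ℤ → ℕ → Set
a ≡ b [mod p ] = + p ℤ.∣ a ℤ.- b

-- d = S(q), for q ≢ 0.
IsSquarefreePart : ℤ → ℚ → Set
IsSquarefreePart d q = Squarefree d × ∃ λ s → q ≡ fromℤ d ℚ.* (s ℚ.* s)

Infinite : Pred ℤ 0ℓ → Set
Infinite P = ∀ (xs : List ℤ) → ∃ λ x → P x × x ∉ xs

-- With multiplicity; the value at 0 is junk.
primeFactors : ℕ → List ℕ
primeFactors zero      = []
primeFactors n@(suc _) = PrimeFactorisation.factors (factorise n)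

-- Degree exactly n, constant coefficient first.
record Polynomial (n : ℕ) : Set where
  field
    coeffs    : Vec ℤ (suc n)
    leading≢0 : last coeffs ≢ 0ℤ

  leading : ℤ
  leading = last coeffs

open Polynomial

evalℚ : List ℚ → ℚ → ℚ
evalℚ cs x = foldr (λ c y → c ℚ.+ x ℚ.* y) 0ℚ cs

evalℤ : ∀ {k} → Vec ℤ k → ℚ → ℚ
evalℤ cs = evalℚ (List.map fromℤ (toList cs))

⟦_⟧ : ∀ {n} → Polynomial n → ℚ → ℚ
⟦ f ⟧ = evalℤ (coeffs f)

derivative : ∀ {n} → Vec ℤ (suc n) → Vec ℤ n
derivative cs = tabulate λ i → + suc (toℕ i) ℤ.* lookup (tail cs) i

-- f and f′ generate the unit ideal of ℚ[x]; the identity u f + v f′ = 1 in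
-- ℚ[x] is expressed by the equality of the polynomial functions on the
-- infinite field ℚ.
Separable : ∀ {n} → Polynomial n → Set
Separable f = ∃₂ λ (u v : List ℚ) → ∀ x →
  evalℚ u x ℚ.* ⟦ f ⟧ x ℚ.+ evalℚ v x ℚ.* evalℤ (derivative (coeffs f)) x ≡ 1ℚ

𝒮 : ∀ {n} → Polynomial n → Pred ℤ 0ℓ
𝒮 f d = ∃ λ r → ⟦ f ⟧ r ≢ 0ℚ × IsSquarefreePart d (⟦ f ⟧ r)

-- Laplace expansion along the first row.
det : ∀ n → (Fin n → Fin n → ℤ) → ℤ
det zero    M = 1ℤ
det (suc n) M = Vector.foldr ℤ._+_ 0ℤ λ j →
  -1ℤ ℤ.^ toℕ j ℤ.* M Fin.zero j ℤ.* det n (λ i k → M (Fin.suc i) (punchIn j k))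

-- The entry in column j of the row 0 … 0 a_n … a_0 0 … 0 starting with k zeros.
sylvesterRow : ∀ {n} → Vec ℤ n → ℕ → ℕ → ℤ
sylvesterRow cs k j = entry (replicate k 0ℤ ++ toList (reverse cs)) j
  where
  entry : List ℤ → ℕ → ℤ
  entry []       _       = 0ℤ
  entry (a ∷ _)  zero    = a
  entry (_ ∷ as) (suc j) = entry as j

resultant : ∀ m n → Vec ℤ (suc m) → Vec ℤ (suc n) → ℤ
resultant m n f g = det (n ℕ.+ m) λ i j →
  [ (λ k → sylvesterRow f (toℕ k) (toℕ j))
  , (λ k → sylvesterRow g (toℕ k) (toℕ j)) ]′ (splitAt n i)

-- (-1)^(n(n-1)/2) Res(f, f′) / a_n, where n = suc k; the division is exact.
disc : ∀ {k} → Polynomial (suc k) → ℤ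
disc {k} f = ℤ._/_
  (-1ℤ ℤ.^ (suc k ℕ.* k ℕ./ 2) ℤ.* resultant (suc k) k (coeffs f) (derivative (coeffs f)))
  (leading f) {{ℤ.≢-nonZero (leading≢0 f)}}

-- The discriminant of degree n polynomials is an integral polynomial in the
-- coefficients, so when p ∤ a_n the discriminant of f̄ ∈ 𝔽_p[x] is disc f mod p.
Good : ∀ {k} → ℕ → Polynomial (suc k) → Set
Good p f = Prime p × p ≢ 2 × ¬ (+ p ℤ.∣ leading f) × ¬ (+ p ℤ.∣ disc f)

-- y² = A x³ + B x² + C x + D
record EllipticCurve : Set where
  field
    A B C D : ℚ
    A≢0     : A ≢ 0ℚ

  cubicDisc : ℚ
  cubicDisc = fromℤ (+ 18) ℚ.* A ℚ.* B ℚ.* C ℚ.* D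
        ℚ.- fromℤ (+ 4) ℚ.* B ℚ.* B ℚ.* B ℚ.* D
        ℚ.+ B ℚ.* B ℚ.* C ℚ.* C
        ℚ.- fromℤ (+ 4) ℚ.* A ℚ.* C ℚ.* C ℚ.* C
        ℚ.- fromℤ (+ 27) ℚ.* A ℚ.* A ℚ.* D ℚ.* D

  field
    cubicDisc≢0 : cubicDisc ≢ 0ℚ

  g : ℚ → ℚ
  g = evalℚ (D ∷ C ∷ B ∷ A ∷ [])

  g′ : ℚ → ℚ
  g′ = evalℚ (C ∷ fromℤ (+ 2) ℚ.* B ∷ fromℤ (+ 3) ℚ.* A ∷ [])

-- Division with the junk value 0 for the divisor 0.
infixl 7 _÷₀_
_÷₀_ : ℚ → ℚ → ℚ
p ÷₀ q with q ℚ.≟ 0ℚ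
... | yes _  = 0ℚ
... | no q≢0 = ℚ._÷_ p q {{ℚ.≢-nonZero q≢0}}

data Point : Set where
  O   : Point
  ⟨_,_⟩ : ℚ → ℚ → Point

-- The twist E_d : d y² = g(x), for d ≢ 0.  E itself is the case d = 1.  The
-- operations are the chord and tangent formulas on coordinates; they are
-- meaningful on points satisfying OnCurve, where no division by 0 occurs.
module Twist (E : EllipticCurve) (d : ℤ) where
  open EllipticCurve E

  OnCurve : Pred Point 0ℓ
  OnCurve O         = ⊤
  OnCurve ⟨ x , y ⟩ = fromℤ d ℚ.* (y ℚ.* y) ≡ g x

  neg : Point → Point
  neg O         = O
  neg ⟨ x , y ⟩ = ⟨ x , ℚ.- y ⟩

  -- The third intersection point with the line of slope s through
  -- ⟨ x₁ , y₁ ⟩ and a point with abscissa x₂, reflected in the x-axis.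
  thirdPoint : (s x₁ y₁ x₂ : ℚ) → Point
  thirdPoint s x₁ y₁ x₂ = ⟨ x₃ , ℚ.- (y₁ ℚ.+ s ℚ.* (x₃ ℚ.- x₁)) ⟩
    where
    x₃ : ℚ
    x₃ = (fromℤ d ℚ.* (s ℚ.* s) ℚ.- B) ÷₀ A ℚ.- x₁ ℚ.- x₂

  infixl 6 _⊕_
  _⊕_ : Point → Point → Point
  O           ⊕ Q           = Q
  ⟨ x₁ , y₁ ⟩ ⊕ O           = ⟨ x₁ , y₁ ⟩
  ⟨ x₁ , y₁ ⟩ ⊕ ⟨ x₂ , y₂ ⟩ with x₁ ℚ.≟ x₂ | y₁ ℚ.≟ ℚ.- y₂
  ... | no _  | _     = thirdPoint ((y₂ ℚ.- y₁) ÷₀ (x₂ ℚ.- x₁)) x₁ y₁ x₂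
  ... | yes _ | yes _ = O
  ... | yes _ | no _  = thirdPoint (g′ x₁ ÷₀ (fromℤ (+ 2) ℚ.* fromℤ d ℚ.* y₁)) x₁ y₁ x₂

  rawMonoid : RawMonoid 0ℓ 0ℓ
  rawMonoid = record { Carrier = Point ; _≈_ = _≡_ ; _∙_ = _⊕_ ; ε = O }

  open RawMonoidDefs rawMonoid using (sum) renaming (_×_ to _·ℕ_)

  infixr 8 _·_
  _·_ : ℤ → Point → Point
  (+ n)    · P = n ·ℕ P
  -[1+ n ] · P = neg (suc n ·ℕ P)

  combination : ∀ {r} → (Fin r → ℤ) → (Fin r → Point) → Point
  combination n P = sum λ i → n i · P i

  Independent : ∀ {r} → (Fin r → Point) → Set
  Independent P = ∀ n → combination n P ≡ O → ∀ i → n i ≡ 0ℤ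

  -- rank E_d(ℚ) = r : there are r independent points of E_d(ℚ) whose span
  -- contains a nonzero multiple of every point.
  HasRank : ℕ → Set
  HasRank r = ∃ λ (P : Fin r → Point) →
    (∀ i → OnCurve (P i)) ×
    Independent P ×
    (∀ Q → OnCurve Q → ∃₂ λ k n → k ≢ 0ℤ × k · Q ≡ combination n P)

-- y² + a₁ x y + a₃ y = x³ + a₂ x² + a₄ x + a₆
record Weierstrass : Set where
  constructor weierstrass
  field
    a₁ a₂ a₃ a₄ a₆ : ℤ

  open import Data.Integer.Base using (_+_; _*_; _-_; -_)

  b₂ b₄ b₆ b₈ Δ : ℤ
  b₂ = a₁ * a₁ + + 4 * a₂
  b₄ = + 2 * a₄ + a₁ * a₃
  b₆ = a₃ * a₃ + + 4 * a₆
  b₈ = a₁ * a₁ * a₆ + + 4 * a₂ * a₆ - a₁ * a₃ * a₄ + a₂ * a₃ * a₃ - a₄ * a₄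
  Δ  = - (b₂ * b₂ * b₈) - + 8 * b₄ * b₄ * b₄ - + 27 * b₆ * b₆ + + 9 * b₂ * b₄ * b₆

-- The substitution x ↦ x + r, y ↦ y + s x + t.
change : (r s t : ℤ) → Weierstrass → Weierstrass
change r s t (weierstrass a₁ a₂ a₃ a₄ a₆) = weierstrass
  (a₁ + + 2 * s)
  (a₂ - s * a₁ + + 3 * r - s * s)
  (a₃ + r * a₁ + + 2 * t)
  (a₄ - s * a₃ + + 2 * r * a₂ - (t + r * s) * a₁ + + 3 * r * r - + 2 * s * t)
  (a₆ + r * a₄ + r * r * a₂ + r * r * r - t * a₃ - t * t - r * t * a₁)
  where open import Data.Integer.Base using (_+_; _*_; _-_)

data Kodaira : Set where
  I I* : ℕ → Kodaira
  II III IV IV* III* II* : Kodaira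

-- Number of irreducible components of the special fibre, over the algebraic
-- closure and without multiplicity.
components : Kodaira → ℕ
components (I zero)    = 1
components (I (suc n)) = suc n
components II          = 1
components III         = 2
components IV          = 3
components (I* n)      = 5 ℕ.+ n
components IV*         = 7
components III*        = 8
components II*         = 9

-- Tate's algorithm for an integral Weierstrass equation at a prime p.
-- All roots modulo p that are needed are rational over 𝔽_p, and are found by
-- running through the residues 0, …, p - 1.
module Tate (p : ℕ) where

  infix 4 p^_∣_
  p^_∣_ : ℕ → ℤ → Bool
  p^ k ∣ a = does (p ℕ.^ k ∣? ∣ a ∣)

  quotient : ℤ → ℕ → ℤ
  quotient a zero      = 0ℤ
  quotient a n@(suc _) = a ℤ./ℕ n

  -- a / p^k, used when p^k divides a
  _/p^_ : ℤ → ℕ → ℤ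
  a /p^ k = quotient a (p ℕ.^ k)

  -- The fuel ∣ a ∣ suffices for a ≢ 0 and p > 1.
  ord : ℤ → ℕ
  ord a = go ∣ a ∣ a
    where
    go : ℕ → ℤ → ℕ
    go zero    a = 0
    go (suc k) a = if p^ 1 ∣ a then suc (go k (a /p^ 1)) else 0

  residues : List ℤ
  residues = List.map +_ (upTo p)

  P^ : ℕ → ℤ
  P^ k = + (p ℕ.^ k)

  -- A double root of a X² + b X + c modulo p, where p ∤ a.
  doubleRoot : (a b c : ℤ) → Maybe ℤ
  doubleRoot a b c = findᵇ
    (λ x → (p^ 1 ∣ a * x * x + b * x + c) ∧ (p^ 1 ∣ + 2 * a * x + b)) residues
    where open import Data.Integer.Base using (_+_; _*_)

  -- A multiple root of X³ + a X² + b X + c modulo p.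
  multipleRoot : (a b c : ℤ) → Maybe ℤ
  multipleRoot a b c = findᵇ
    (λ x → (p^ 1 ∣ x * x * x + a * x * x + b * x + c)
         ∧ (p^ 1 ∣ + 3 * x * x + + 2 * a * x + b)) residues
    where open import Data.Integer.Base using (_+_; _*_)

  firstGood : (Weierstrass → Bool) → (ℤ × ℤ → Weierstrass) → Weierstrass
  firstGood good W = fromMaybe (W (0ℤ , 0ℤ))
    (findᵇ good (List.map W (cartesianProduct residues residues)))

  -- Moves the singular point modulo p to (0, 0).
  moveSingularPoint : Weierstrass → Weierstrass
  moveSingularPoint W = firstGood
    (λ W′ → let open Weierstrass W′ in (p^ 1 ∣ a₃) ∧ (p^ 1 ∣ a₄) ∧ (p^ 1 ∣ a₆))
    (λ (r , t) → change r 0ℤ t W)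

  -- Achieves p ∣ a₁, a₂; p² ∣ a₃, a₄; p³ ∣ a₆.
  prepareCubic : Weierstrass → Weierstrass
  prepareCubic W = firstGood
    (λ W′ → let open Weierstrass W′ in
       (p^ 1 ∣ a₁) ∧ (p^ 1 ∣ a₂) ∧ (p^ 2 ∣ a₃) ∧ (p^ 2 ∣ a₄) ∧ (p^ 3 ∣ a₆))
    (λ (s , t) → change 0ℤ s (P^ 1 ℤ.* t) W)

  -- The n of type I*ₙ.  Called with j = 2 on an equation whose cubic has its
  -- double root at 0; round j decides n = 2j - 3 and n = 2j - 2.
  starLength : (fuel j : ℕ) → Weierstrass → ℕ
  starLength zero       j W = 0
  starLength (suc fuel) j W with doubleRoot 1ℤ (a₃ /p^ j) (ℤ.- (a₆ /p^ (2 ℕ.* j)))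
    where open Weierstrass W
  ... | nothing = 2 ℕ.* j ℕ.∸ 3
  ... | just y  = round₂ (change 0ℤ 0ℤ (P^ j ℤ.* y) W)
    where
    round₂ : Weierstrass → ℕ
    round₂ W′ with doubleRoot (a₂ /p^ 1) (a₄ /p^ suc j) (a₆ /p^ suc (2 ℕ.* j))
      where open Weierstrass W′
    ... | nothing = 2 ℕ.* j ℕ.∸ 2
    ... | just x  = starLength fuel (suc j) (change (P^ j ℤ.* x) 0ℤ 0ℤ W′)

  scaleDown : Weierstrass → Weierstrass
  scaleDown (weierstrass a₁ a₂ a₃ a₄ a₆) =
    weierstrass (a₁ /p^ 1) (a₂ /p^ 2) (a₃ /p^ 3) (a₄ /p^ 4) (a₆ /p^ 6)

  -- The Kodaira type, and ord of the minimal discriminant.  Each restart lowers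
  -- ord Δ by 12.
  tate : (fuel : ℕ) → Weierstrass → Kodaira × ℕ
  tate zero       W = I 0 , 0
  tate (suc fuel) W =
    if p^ 1 ∣ Weierstrass.Δ W then singular (moveSingularPoint W) else (I 0 , 0)
    where
    v : ℕ
    v = ord (Weierstrass.Δ W)

    -- The cubic has a triple root at 0.
    tripleRoot : Weierstrass → Kodaira × ℕ
    tripleRoot W₂ with doubleRoot 1ℤ (a₃ /p^ 2) (ℤ.- (a₆ /p^ 4))
      where open Weierstrass W₂
    ... | nothing = IV* , v
    ... | just y  =
      if p^ 4 ∣ a₄ then (if p^ 6 ∣ a₆ then tate fuel (scaleDown W₃) else (II* , v))
      else (III* , v)
      where
      W₃ : Weierstrass
      W₃ = change 0ℤ 0ℤ (P^ 2 ℤ.* y) W₂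
      open Weierstrass W₃

    cubic : Weierstrass → Kodaira × ℕ
    cubic W₁ with multipleRoot (a₂ /p^ 1) (a₄ /p^ 2) (a₆ /p^ 3)
      where open Weierstrass W₁
    ... | nothing = I* 0 , v
    ... | just x  =
      if p^ 2 ∣ Weierstrass.a₂ W₂ then tripleRoot W₂ else (I* (starLength v 2 W₂) , v)
      where
      W₂ : Weierstrass
      W₂ = change (P^ 1 ℤ.* x) 0ℤ 0ℤ W₁

    singular : Weierstrass → Kodaira × ℕ
    singular W₀ =
      if p^ 1 ∣ b₂ then
        (if p^ 2 ∣ a₆ then
          (if p^ 3 ∣ b₈ then
            (if p^ 3 ∣ b₆ then cubic (prepareCubic W₀)
             else (IV , v))
           else (III , v))
         else (II , v))
      else (I v , v)
      where open Weierstrass W₀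

  -- Ogg's formula.
  conductorExponent : Weierstrass → ℕ
  conductorExponent W = let κ , v = tate (suc (ord (Weierstrass.Δ W))) W in
    suc v ℕ.∸ components κ

module _ (E : EllipticCurve) where
  open EllipticCurve E

  -- (x, y) ↦ (u² A x, u³ A y) takes E to
  -- y² = x³ + u² B x² + u⁴ A C x + u⁶ A² D,
  -- where u clears the denominators of B, A C and A² D.
  integralModel : Weierstrass
  integralModel = weierstrass 0ℤ (↥ (B ℚ.* u²)) 0ℤ (↥ (A ℚ.* C ℚ.* u² ℚ.* u²))
    (↥ (A ℚ.* A ℚ.* D ℚ.* u² ℚ.* u² ℚ.* u²))
    where
    u u² : ℚ
    u  = fromℤ (+ (↧ₙ B ℕ.* ↧ₙ (A ℚ.* C) ℕ.* ↧ₙ (A ℚ.* A ℚ.* D)))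
    u² = u ℚ.* u

  conductor : ℕ
  conductor = product (List.map
    (λ p → p ℕ.^ Tate.conductorExponent p integralModel)
    (deduplicate ℕ._≟_ (primeFactors ∣ Weierstrass.Δ integralModel ∣)))

fundamentalDiscriminant : ℤ → ℤ
fundamentalDiscriminant d = if does (4 ∣? ∣ d ℤ.- 1ℤ ∣) then d else + 4 ℤ.* d

-- (D / q) for a prime q; the Legendre symbol when q ≢ 2.
kroneckerPrime : ℤ → ℕ → ℤ
kroneckerPrime D 2 =
  if does (2 ∣? ∣ D ∣) then 0ℤ
  else if does (8 ∣? ∣ D ℤ.- 1ℤ ∣) then 1ℤ
  else if does (8 ∣? ∣ D ℤ.+ 1ℤ ∣) then 1ℤ
  else -1ℤ
kroneckerPrime D q =
  if does (q ∣? ∣ D ∣) then 0ℤ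
  else if any (λ x → does (q ∣? ∣ D ℤ.- + (x ℕ.* x) ∣)) (upTo q) then 1ℤ
  else -1ℤ

kroneckerUnit : ℤ → ℤ
kroneckerUnit (+ _)    = 1ℤ
kroneckerUnit -[1+ _ ] = -1ℤ

kronecker : ℤ → ℤ → ℤ
kronecker D (+ 0)       = if does (∣ D ∣ ℕ.≟ 1) then 1ℤ else 0ℤ
kronecker D n@(+ suc _) = foldr ℤ._*_ 1ℤ (List.map (kroneckerPrime D) (primeFactors ∣ n ∣))
kronecker D n@(-[1+ _ ]) = kroneckerUnit D ℤ.*
  foldr ℤ._*_ 1ℤ (List.map (kroneckerPrime D) (primeFactors ∣ n ∣))

χ : ℤ → ℤ → ℤ
χ d = kronecker (fundamentalDiscriminant d)

-- The ranks are relational, so that equating parities asserts that they exist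
-- (the Mordell–Weil theorem).  The field ℚ(√d) has to be unramified at the
-- primes of bad reduction: for conductor E even and d ≡ 3 (mod 4), d may be
-- coprime to 2 * conductor E although χ d (- conductor E) is 0.
ParityConjecture : Set
ParityConjecture = ∀ (E : EllipticCurve) (d : ℤ) → let N = + conductor E in
  Squarefree d →
  ℤ.Coprime d (+ 2 ℤ.* N) →
  ℤ.Coprime (fundamentalDiscriminant d) N →
  ∃₂ λ r r′ → Twist.HasRank E 1ℤ r × Twist.HasRank E d r′ ×
    -1ℤ ℤ.^ r′ ≡ -1ℤ ℤ.^ r ℤ.* χ d (ℤ.- N)

{-# OPTIONS --safe #-}
module Submission where

-- Translating the rational root r to 0 and inverting, f(r + 1/t) = g(t)/t⁴ for
-- a cubic g, so the squarefree D ∈ 𝒮(f) come from points with y ≠ 0 on D y² = g(x).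
-- Take a large squarefree d₁ ≡ m (mod p) and let E be y² = d₁ g(x).  If E has
-- positive rank, a point of infinite order shows d₁ ∈ 𝒮(f).  Otherwise E has rank 0;
-- for d₂ < 0 squarefree with d₂ ≡ 1 modulo 8 N_E d₁ p we have
-- χ_{d₂}(-N_E) = sign(d₂) = -1, so E_{d₂} has odd rank and d₁ d₂ ∈ 𝒮(f), where
-- d₁ d₂ ≡ m (mod p).  Choosing d₁ first means that the rank of E has to be well
-- defined only when it is 0, so no group law on E(ℚ) is needed.

open import Defs
open import Data.Bool.Base using (if_then_else_)
open import Data.Empty using (⊥; ⊥-elim)
open import Data.Fin.Base using (Fin; zero; suc)
open import Data.Integer.Base as ℤ using (ℤ; +_; -[1+_]; ∣_∣; 0ℤ; 1ℤ; -1ℤ)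
open import Data.Integer.Coprimality using (Coprime)
import Data.Integer.Coprimality as ℤ
import Data.Integer.DivMod as ℤ
import Data.Integer.Divisibility.Signed as Signed
import Data.Integer.Properties as ℤ
import Data.Integer.Tactic.RingSolver as ℤ-Solver
open import Data.List.Base as List using (List; []; _∷_; foldr)
open import Data.List.Membership.Propositional using (_∈_)
open import Data.List.Membership.Propositional.Properties using (∈-deduplicate⁻)
open import Data.List.Relation.Unary.All as All using (All; []; _∷_)
import Data.List.Relation.Unary.All.Properties as All
open import Data.List.Relation.Unary.Any using (here; there)
open import Data.Nat.Base using (ℕ; zero; suc)
import Data.Nat.Coprimality as ℕ
import Data.Nat.Tactic.RingSolver as ℕ-Solver
open import Data.Product.Base using (_×_; _,_; ∃; ∃₂; proj₁; proj₂)
open import Data.Rational.Base as ℚ using (ℚ; 0ℚ; 1ℚ; mkℚ)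
open import Data.Rational.Literals using (fromℤ)
import Data.Rational.Properties as ℚ
import Data.Rational.Unnormalised.Base as ℚᵘ
import Data.Rational.Unnormalised.Properties as ℚᵘ
open import Data.Sum.Base using (inj₁; inj₂)
open import Data.Vec.Base using ([]; _∷_)
open import Function.Base using (_∘_)
open import Level using (0ℓ)
open import Relation.Binary.PropositionalEquality
open import Relation.Nullary using (¬_; Dec; does; yes; no; contradiction)
open import Relation.Nullary.Decidable using (¬?; dec⇒maybe; dec-true; dec-false; decidable-stable)
open import Relation.Unary using (Pred; Decidable)
import Tactic.RingSolver as ℚ-Solver
open import Tactic.RingSolver.Core.AlmostCommutativeRing using (AlmostCommutativeRing; fromCommutativeRing)

-- Cubics and quartics over ℚ

module Rational where
  open import Data.Rational.Base
  open import Data.Rational.Properties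

  ℚ-ring : AlmostCommutativeRing _ _
  ℚ-ring = fromCommutativeRing +-*-commutativeRing (λ x → dec⇒maybe (0ℚ ≟ x))

  module _ {p : ℚ} (p≢0 : p ≢ 0ℚ) where
    inverse : ∃ λ q → q * p ≡ 1ℚ
    inverse = (1/ p) {{≢-nonZero p≢0}} , *-inverseˡ p {{≢-nonZero p≢0}}

    *-cancelˡ-0 : ∀ {q} → p * q ≡ 0ℚ → q ≡ 0ℚ
    *-cancelˡ-0 {q} pq≡0 = let p⁻¹ , p⁻¹p≡1 = inverse in begin
      q               ≡⟨ *-identityˡ q ⟨
      1ℚ * q          ≡⟨ cong (_* q) p⁻¹p≡1 ⟨
      p⁻¹ * p * q     ≡⟨ *-assoc p⁻¹ p q ⟩
      p⁻¹ * (p * q)   ≡⟨ cong (p⁻¹ *_) pq≡0 ⟩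
      p⁻¹ * 0ℚ        ≡⟨ *-zeroʳ p⁻¹ ⟩
      0ℚ              ∎
      where open ≡-Reasoning

    *-≢0 : ∀ {q} → q ≢ 0ℚ → p * q ≢ 0ℚ
    *-≢0 q≢0 = q≢0 ∘ *-cancelˡ-0

  -- Discriminants and double roots of cubics

  module _ (a b c d : ℚ) where
    cubic cubic′ : ℚ → ℚ
    cubic  x = d + x * (c + x * (b + x * a))
    cubic′ x = c + x * (fromℤ (+ 2) * b + x * (fromℤ (+ 3) * a))

    discriminant : ℚ
    discriminant = fromℤ (+ 18) * a * b * c * d
      - fromℤ (+ 4) * b * b * b * d
      + b * b * c * c
      - fromℤ (+ 4) * a * c * c * c
      - fromℤ (+ 27) * a * a * d * d

    -- Dividing 9a times the cubic by its derivative leaves the remainder Δ₁ - 2Δ₀x, so a double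
    -- root x satisfies 2Δ₀x = Δ₁.
    Δ₀ Δ₁ : ℚ
    Δ₀ = b * b - fromℤ (+ 3) * a * c
    Δ₁ = fromℤ (+ 9) * a * d - b * c

  cubic-mod-cubic′ : ∀ a b c d x →
    fromℤ (+ 9) * a * (d + x * (c + x * (b + x * a))) ≡
    (c + x * (fromℤ (+ 2) * b + x * (fromℤ (+ 3) * a))) * (fromℤ (+ 3) * a * x + b) +
    ((fromℤ (+ 9) * a * d - b * c) - fromℤ (+ 2) * (b * b - fromℤ (+ 3) * a * c) * x)
  cubic-mod-cubic′ = ℚ-Solver.solve-∀ ℚ-ring

  -- The left side is the derivative at Δ₁/(2Δ₀), the root of that remainder, multiplied by 4Δ₀² to
  -- clear denominators.
  cubic′-discriminant : ∀ a b c d →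
    fromℤ (+ 3) * a * (fromℤ (+ 9) * a * d - b * c) * (fromℤ (+ 9) * a * d - b * c)
      + fromℤ (+ 4) * b * (fromℤ (+ 9) * a * d - b * c) * (b * b - fromℤ (+ 3) * a * c)
      + fromℤ (+ 4) * c * (b * b - fromℤ (+ 3) * a * c) * (b * b - fromℤ (+ 3) * a * c) ≡
    - (fromℤ (+ 9) * a *
      (fromℤ (+ 18) * a * b * c * d
        - fromℤ (+ 4) * b * b * b * d
        + b * b * c * c
        - fromℤ (+ 4) * a * c * c * c
        - fromℤ (+ 27) * a * a * d * d))
  cubic′-discriminant = ℚ-Solver.solve-∀ ℚ-ring

  module _ (a b c d : ℚ) (a≢0 : a ≢ 0ℚ) (disc≡0 : discriminant a b c d ≡ 0ℚ) where
    private
      δ₀ δ₁ : ℚ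
      δ₀ = Δ₀ a b c d
      δ₁ = Δ₁ a b c d

    relation : fromℤ (+ 3) * a * δ₁ * δ₁ + fromℤ (+ 4) * b * δ₁ * δ₀ + fromℤ (+ 4) * c * δ₀ * δ₀ ≡ 0ℚ
    relation = begin
      _                                            ≡⟨ cubic′-discriminant a b c d ⟩
      - (fromℤ (+ 9) * a * discriminant a b c d)   ≡⟨ cong (λ z → - (fromℤ (+ 9) * a * z)) disc≡0 ⟩
      - (fromℤ (+ 9) * a * 0ℚ)                     ≡⟨ cong -_ (*-zeroʳ (fromℤ (+ 9) * a)) ⟩
      0ℚ                                           ∎
      where open ≡-Reasoning

    cubic-root : ∀ x → cubic′ a b c d x ≡ 0ℚ → δ₁ ≡ fromℤ (+ 2) * δ₀ * x → cubic a b c d x ≡ 0ℚ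
    cubic-root x c′≡0 δ₁≡ = *-cancelˡ-0 (*-≢0 {fromℤ (+ 9)} (λ ()) a≢0) (begin
      fromℤ (+ 9) * a * cubic a b c d x    ≡⟨ cubic-mod-cubic′ a b c d x ⟩
      cubic′ a b c d x * l + (δ₁ - fromℤ (+ 2) * δ₀ * x)
        ≡⟨ cong₂ (λ u v → u * l + (v - fromℤ (+ 2) * δ₀ * x)) c′≡0 δ₁≡ ⟩
      0ℚ * l + (fromℤ (+ 2) * δ₀ * x - fromℤ (+ 2) * δ₀ * x)
        ≡⟨ cong₂ _+_ (*-zeroˡ l) (+-inverseʳ (fromℤ (+ 2) * δ₀ * x)) ⟩
      0ℚ                                   ∎)
      where
      open ≡-Reasoning
      l : ℚ
      l = fromℤ (+ 3) * a * x + b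

    -- The root is -b/(3a) if Δ₀ = 0, when it is triple, and Δ₁/(2Δ₀) otherwise.
    doubleRoot : ∃ λ x → cubic a b c d x ≡ 0ℚ × cubic′ a b c d x ≡ 0ℚ
    doubleRoot with δ₀ ≟ 0ℚ
    ... | yes δ₀≡0 = x , cubic-root x c′≡0 (trans δ₁≡0 (sym (begin
        fromℤ (+ 2) * δ₀ * x    ≡⟨ cong (λ z → fromℤ (+ 2) * z * x) δ₀≡0 ⟩
        fromℤ (+ 2) * 0ℚ * x    ≡⟨ *-zeroˡ x ⟩
        0ℚ                      ∎))) , c′≡0
      where
      open ≡-Reasoning
      3a≢0 : fromℤ (+ 3) * a ≢ 0ℚ
      3a≢0 = *-≢0 {fromℤ (+ 3)} (λ ()) a≢0
      i x : ℚ
      i = proj₁ (inverse 3a≢0)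
      x = - b * i
      3ax≡-b : fromℤ (+ 3) * a * x ≡ - b
      3ax≡-b = trans (e (fromℤ (+ 3) * a) b i) (trans (cong (- b *_) (proj₂ (inverse 3a≢0))) (*-identityʳ (- b)))
        where
        e : ∀ t b i → t * (- b * i) ≡ - b * (i * t)
        e = ℚ-Solver.solve-∀ ℚ-ring
      c′≡0 : cubic′ a b c d x ≡ 0ℚ
      -- Completing the square: 3a times the derivative is (3ax + b)² - Δ₀.
      c′≡0 = *-cancelˡ-0 3a≢0 (begin
        fromℤ (+ 3) * a * cubic′ a b c d x     ≡⟨ e a b c x ⟩
        (fromℤ (+ 3) * a * x + b) * (fromℤ (+ 3) * a * x + b) - δ₀
          ≡⟨ cong₂ (λ u v → (u + b) * (u + b) - v) 3ax≡-b δ₀≡0 ⟩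
        (- b + b) * (- b + b) - 0ℚ              ≡⟨ cong (λ z → z * z - 0ℚ) (+-inverseˡ b) ⟩
        0ℚ                                      ∎)
        where
        e : ∀ a b c x → fromℤ (+ 3) * a * (c + x * (fromℤ (+ 2) * b + x * (fromℤ (+ 3) * a))) ≡
            (fromℤ (+ 3) * a * x + b) * (fromℤ (+ 3) * a * x + b) - (b * b - fromℤ (+ 3) * a * c)
        e = ℚ-Solver.solve-∀ ℚ-ring
      -- With Δ₀ = 0, `relation` reduces to 3aΔ₁² = 0.
      δ₁≡0 : δ₁ ≡ 0ℚ
      δ₁≡0 with δ₁ ≟ 0ℚ
      ... | yes δ₁≡0 = δ₁≡0
      ... | no δ₁≢0  = contradiction (begin
        fromℤ (+ 3) * a * δ₁ * δ₁     ≡⟨ e (fromℤ (+ 3) * a * δ₁ * δ₁) (fromℤ (+ 4) * b * δ₁) (fromℤ (+ 4) * c) ⟨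
        fromℤ (+ 3) * a * δ₁ * δ₁ + fromℤ (+ 4) * b * δ₁ * 0ℚ + fromℤ (+ 4) * c * 0ℚ * 0ℚ
          ≡⟨ cong (λ z → fromℤ (+ 3) * a * δ₁ * δ₁ + fromℤ (+ 4) * b * δ₁ * z + fromℤ (+ 4) * c * z * z) δ₀≡0 ⟨
        _                             ≡⟨ relation ⟩
        0ℚ                            ∎) (*-≢0 (*-≢0 3a≢0 δ₁≢0) δ₁≢0)
        where
        e : ∀ p q r → p + q * 0ℚ + r * 0ℚ * 0ℚ ≡ p
        e = ℚ-Solver.solve-∀ ℚ-ring
    ... | no δ₀≢0 = x , cubic-root x c′≡0 (sym 2δ₀x≡δ₁) , c′≡0
      where
      open ≡-Reasoning
      2δ₀≢0 : fromℤ (+ 2) * δ₀ ≢ 0ℚ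
      2δ₀≢0 = *-≢0 {fromℤ (+ 2)} (λ ()) δ₀≢0
      i x : ℚ
      i = proj₁ (inverse 2δ₀≢0)
      x = δ₁ * i
      2δ₀x≡δ₁ : fromℤ (+ 2) * δ₀ * x ≡ δ₁
      2δ₀x≡δ₁ = trans (e (fromℤ (+ 2) * δ₀) δ₁ i) (trans (cong (δ₁ *_) (proj₂ (inverse 2δ₀≢0))) (*-identityʳ δ₁))
        where
        e : ∀ t b i → t * (b * i) ≡ b * (i * t)
        e = ℚ-Solver.solve-∀ ℚ-ring
      c′≡0 : cubic′ a b c d x ≡ 0ℚ
      -- Multiplied by (2Δ₀)², the derivative at Δ₁/(2Δ₀) becomes the left side of `relation`.
      c′≡0 = *-cancelˡ-0 (*-≢0 2δ₀≢0 2δ₀≢0) (begin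
        fromℤ (+ 2) * δ₀ * (fromℤ (+ 2) * δ₀) * cubic′ a b c d x    ≡⟨ e a b c δ₀ x ⟩
        fromℤ (+ 3) * a * (fromℤ (+ 2) * δ₀ * x) * (fromℤ (+ 2) * δ₀ * x)
          + fromℤ (+ 4) * b * (fromℤ (+ 2) * δ₀ * x) * δ₀ + fromℤ (+ 4) * c * δ₀ * δ₀
          ≡⟨ cong (λ z → fromℤ (+ 3) * a * z * z + fromℤ (+ 4) * b * z * δ₀ + fromℤ (+ 4) * c * δ₀ * δ₀) 2δ₀x≡δ₁ ⟩
        _                                       ≡⟨ relation ⟩
        0ℚ                                      ∎)
        where
        e : ∀ a b c δ x → fromℤ (+ 2) * δ * (fromℤ (+ 2) * δ) * (c + x * (fromℤ (+ 2) * b + x * (fromℤ (+ 3) * a))) ≡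
          fromℤ (+ 3) * a * (fromℤ (+ 2) * δ * x) * (fromℤ (+ 2) * δ * x)
            + fromℤ (+ 4) * b * (fromℤ (+ 2) * δ * x) * δ + fromℤ (+ 4) * c * δ * δ
        e = ℚ-Solver.solve-∀ ℚ-ring

  -- The discriminant of a cubic is unchanged when the coefficients are reversed, and homogeneous of
  -- degree 4 in them.
  discriminant-reverse : ∀ e a b c d →
    fromℤ (+ 18) * (e * d) * (e * c) * (e * b) * (e * a)
      - fromℤ (+ 4) * (e * c) * (e * c) * (e * c) * (e * a)
      + (e * c) * (e * c) * (e * b) * (e * b)
      - fromℤ (+ 4) * (e * d) * (e * b) * (e * b) * (e * b)
      - fromℤ (+ 27) * (e * d) * (e * d) * (e * a) * (e * a) ≡
    e * (e * (e * (e * (fromℤ (+ 18) * a * b * c * d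
        - fromℤ (+ 4) * b * b * b * d
        + b * b * c * c
        - fromℤ (+ 4) * a * c * c * c
        - fromℤ (+ 27) * a * a * d * d))))
  discriminant-reverse = ℚ-Solver.solve-∀ ℚ-ring

  evalℚ-scale : ∀ e a b c d x →
    e * a + x * (e * b + x * (e * c + x * (e * d + x * 0ℚ))) ≡
    e * (a + x * (b + x * (c + x * d)))
  evalℚ-scale = ℚ-Solver.solve-∀ ℚ-ring

  -- y² = e (d x³ + c x² + b x + a), with the coefficients of cubic a b c d reversed.
  reversedCurve : ∀ e a b c d → e ≢ 0ℚ → d ≢ 0ℚ → discriminant a b c d ≢ 0ℚ → EllipticCurve
  reversedCurve e a b c d e≢0 d≢0 disc≢0 = record
    { A = e * d ; B = e * c ; C = e * b ; D = e * a
    ; A≢0 = *-≢0 e≢0 d≢0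
    ; cubicDisc≢0 = λ eq → *-≢0 e≢0 (*-≢0 e≢0 (*-≢0 e≢0 (*-≢0 e≢0 disc≢0)))
        (trans (sym (discriminant-reverse e a b c d)) eq)
    }

  -- Translating the rational root to 0 and inverting

  -- Taylor expansion at r, with coefficients f(r), f′(r), f″(r)/2, f‴(r)/6 and a₄. The factors `0ℚ`
  -- come from the end of the fold in `evalℚ`.
  quartic-shift : ∀ a₀ a₁ a₂ a₃ a₄ r x →
    a₀ + (r + x) * (a₁ + (r + x) * (a₂ + (r + x) * (a₃ + (r + x) * (a₄ + (r + x) * 0ℚ)))) ≡
    a₀ + r * (a₁ + r * (a₂ + r * (a₃ + r * (a₄ + r * 0ℚ)))) +
    x * ((a₁ + r * (fromℤ (+ 2) * a₂ + r * (fromℤ (+ 3) * a₃ + r * (fromℤ (+ 4) * a₄ + r * 0ℚ))))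
      + x * ((a₂ + fromℤ (+ 3) * (r * a₃) + fromℤ (+ 6) * (r * r * a₄))
      + x * ((a₃ + fromℤ (+ 4) * (r * a₄)) + x * a₄)))
  quartic-shift = ℚ-Solver.solve-∀ ℚ-ring

  -- The product rule for x k(x), where k is the cubic factor of f(r + x) when f(r) = 0.
  quartic′-shift : ∀ a₁ a₂ a₃ a₄ r x →
    a₁ + (r + x) * (fromℤ (+ 2) * a₂ + (r + x) * (fromℤ (+ 3) * a₃ + (r + x) * (fromℤ (+ 4) * a₄ + (r + x) * 0ℚ))) ≡
    ((a₁ + r * (fromℤ (+ 2) * a₂ + r * (fromℤ (+ 3) * a₃ + r * (fromℤ (+ 4) * a₄ + r * 0ℚ))))
      + x * ((a₂ + fromℤ (+ 3) * (r * a₃) + fromℤ (+ 6) * (r * r * a₄))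
      + x * ((a₃ + fromℤ (+ 4) * (r * a₄)) + x * a₄))) +
    x * ((a₂ + fromℤ (+ 3) * (r * a₃) + fromℤ (+ 6) * (r * r * a₄))
      + x * (fromℤ (+ 2) * (a₃ + fromℤ (+ 4) * (r * a₄)) + x * (fromℤ (+ 3) * a₄)))
  quartic′-shift = ℚ-Solver.solve-∀ ℚ-ring

  module Shift (a₀ a₁ a₂ a₃ a₄ r : ℚ) where
    b c d : ℚ
    b = a₃ + fromℤ (+ 4) * (r * a₄)
    c = a₂ + fromℤ (+ 3) * (r * a₃) + fromℤ (+ 6) * (r * r * a₄)
    d = a₁ + r * (fromℤ (+ 2) * a₂ + r * (fromℤ (+ 3) * a₃ + r * (fromℤ (+ 4) * a₄ + r * 0ℚ)))

    quartic quartic′ : ℚ → ℚ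
    quartic  = evalℚ (a₀ ∷ a₁ ∷ a₂ ∷ a₃ ∷ a₄ ∷ [])
    quartic′ = evalℚ (a₁ ∷ fromℤ (+ 2) * a₂ ∷ fromℤ (+ 3) * a₃ ∷ fromℤ (+ 4) * a₄ ∷ [])

    module _ (root : quartic r ≡ 0ℚ) where
      shift : ∀ x → quartic (r + x) ≡ x * cubic a₄ b c d x
      shift x = trans (quartic-shift a₀ a₁ a₂ a₃ a₄ r x)
        (trans (cong (_+ x * cubic a₄ b c d x) root) (+-identityˡ _))

      shift′ : ∀ x → quartic′ (r + x) ≡ cubic a₄ b c d x + x * cubic′ a₄ b c d x
      shift′ = quartic′-shift a₁ a₂ a₃ a₄ r

      module _ (u v : ℚ → ℚ) (unit : ∀ x → u x * quartic x + v x * quartic′ x ≡ 1ℚ) where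
        no-common-root : ∀ x → quartic x ≡ 0ℚ → quartic′ x ≢ 0ℚ
        no-common-root x f≡0 f′≡0 = contradiction (begin
          0ℚ                                     ≡⟨ e (u x) (v x) ⟨
          u x * 0ℚ + v x * 0ℚ                    ≡⟨ cong₂ (λ s t → u x * s + v x * t) f≡0 f′≡0 ⟨
          u x * quartic x + v x * quartic′ x     ≡⟨ unit x ⟩
          1ℚ                                     ∎) λ ()
          where
          open ≡-Reasoning
          e : ∀ u v → u * 0ℚ + v * 0ℚ ≡ 0ℚ
          e = ℚ-Solver.solve-∀ ℚ-ring

        -- `d` unfolds to `quartic′ r`, and a root of a separable polynomial is simple.
        d≢0 : d ≢ 0ℚ
        d≢0 = no-common-root r root

        -- A double root x of the cubic factor would make r + x a common root of the quartic and its
        -- derivative.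
        disc≢0 : a₄ ≢ 0ℚ → discriminant a₄ b c d ≢ 0ℚ
        disc≢0 a₄≢0 disc≡0 = let x , k≡0 , k′≡0 = doubleRoot a₄ b c d a₄≢0 disc≡0 in
          no-common-root (r + x)
            (trans (shift x) (trans (cong (x *_) k≡0) (*-zeroʳ x)))
            (trans (shift′ x) (trans (cong₂ (λ s t → s + x * t) k≡0 k′≡0) (trans (+-identityˡ _) (*-zeroʳ x))))

  reverse-cubic : ∀ a b c d w x → w * x ≡ 1ℚ →
    w * cubic a b c d w ≡ (w * w) * (w * w) * (a + x * (b + x * (c + x * d)))
  reverse-cubic a b c d w x wx≡1 = begin
    w * cubic a b c d w     ≡⟨ e₁ a b c d w ⟩
    homogeneous 1ℚ          ≡⟨ cong homogeneous wx≡1 ⟨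
    homogeneous (w * x)     ≡⟨ e₂ a b c d w x ⟩
    (w * w) * (w * w) * (a + x * (b + x * (c + x * d))) ∎
    where
    open ≡-Reasoning
    -- The coefficients are weighted by powers of z so that z = 1 gives the left side, and z = w x
    -- gives every term the factor w⁴.
    homogeneous : ℚ → ℚ
    homogeneous z = w * (d * (z * z * z) + c * (z * z) * w + b * z * (w * w) + a * (w * w * w))
    e₁ : ∀ a b c d w → w * (d + w * (c + w * (b + w * a))) ≡
      w * (d * (1ℚ * 1ℚ * 1ℚ) + c * (1ℚ * 1ℚ) * w + b * 1ℚ * (w * w) + a * (w * w * w))
    e₁ = ℚ-Solver.solve-∀ ℚ-ring
    e₂ : ∀ a b c d w x →
      w * (d * ((w * x) * (w * x) * (w * x)) + c * ((w * x) * (w * x)) * w + b * (w * x) * (w * w) + a * (w * w * w)) ≡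
      (w * w) * (w * w) * (a + x * (b + x * (c + x * d)))
    e₂ = ℚ-Solver.solve-∀ ℚ-ring

open Rational

-- Squarefree integers in arithmetic progressions

open import Data.Nat.Base hiding (zero; suc; ℕ)
open import Data.Nat.DivMod
open import Data.Nat.Divisibility
open import Data.Nat.ListAction using (sum; product)
open import Data.Nat.ListAction.Properties using (∈⇒∣product; product≢0)
open import Data.Nat.Primality
open import Data.Nat.Primality.Factorisation using (factorise; module PrimeFactorisation)
open import Data.Nat.Properties

-- Finite sums and counting

∑ : ℕ → (ℕ → ℕ) → ℕ
∑ zero    f = 0
∑ (suc n) f = ∑ n f + f n

∑-mono : ∀ n {f g} → (∀ {i} → i < n → f i ≤ g i) → ∑ n f ≤ ∑ n g
∑-mono zero    f≤g = z≤n
∑-mono (suc n) f≤g = +-mono-≤ (∑-mono n (f≤g ∘ m<n⇒m<1+n)) (f≤g ≤-refl)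

∑-1 : ∀ n → ∑ n (λ _ → 1) ≡ n
∑-1 zero    = refl
∑-1 (suc n) = trans (+-comm (∑ n _) 1) (cong suc (∑-1 n))

∑-zero : ∀ n → ∑ n (λ _ → 0) ≡ 0
∑-zero zero    = refl
∑-zero (suc n) = cong (_+ 0) (∑-zero n)

∑-+ : ∀ n f g → ∑ n (λ i → f i + g i) ≡ ∑ n f + ∑ n g
∑-+ zero    f g = refl
∑-+ (suc n) f g = trans (cong (_+ (f n + g n)) (∑-+ n f g)) (interchange (∑ n f) (∑ n g) (f n) (g n))
  where
  interchange : ∀ a b c d → a + b + (c + d) ≡ a + c + (b + d)
  interchange = ℕ-Solver.solve-∀

∑-comm : ∀ m n (f : ℕ → ℕ → ℕ) → ∑ m (λ i → ∑ n (f i)) ≡ ∑ n (λ j → ∑ m (λ i → f i j))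
∑-comm zero    n f = sym (∑-zero n)
∑-comm (suc m) n f = trans (cong (_+ ∑ n (f m)) (∑-comm m n f)) (sym (∑-+ n _ (f m)))

∑-split : ∀ m n f → ∑ (m + n) f ≡ ∑ m f + ∑ n (λ i → f (m + i))
∑-split m zero    f rewrite +-identityʳ m = sym (+-identityʳ _)
∑-split m (suc n) f rewrite +-suc m n =
  trans (cong (_+ f (m + n)) (∑-split m n f)) (+-assoc (∑ m f) _ _)

term≤∑ : ∀ n f {i} → i < n → f i ≤ ∑ n f
term≤∑ (suc n) f i<1+n with m≤n⇒m<n∨m≡n (s≤s⁻¹ i<1+n)
... | inj₁ i<n  = ≤-trans (term≤∑ n f i<n) (m≤m+n _ _)
... | inj₂ refl = m≤n+m _ _

𝟙 : {P : Set} → Dec P → ℕ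
𝟙 P? = if does P? then 1 else 0

1≤𝟙 : {P : Set} (P? : Dec P) → P → 1 ≤ 𝟙 P?
1≤𝟙 (yes _) p = ≤-refl
1≤𝟙 (no ¬p) p = contradiction p ¬p

module Count {P : Pred ℕ 0ℓ} (P? : Decidable P) (q : ℕ) .{{_ : NonZero q}}
  (spaced : ∀ {i j} → P i → P (i + j) → q ∣ j) where

  -- Two hits in one window of length at most q would differ by a positive multiple of q smaller
  -- than q. The induction removes the last position; a hit there excludes all earlier ones.
  count-short : ∀ b {n} → n ≤ q → ∑ n (λ i → 𝟙 (P? (b + i))) ≤ 1
  count-short b {zero}  _     = z≤n
  count-short b {suc n} 1+n≤q with P? (b + n)
  ... | no _  = ≤-trans (≤-reflexive (+-identityʳ _)) (count-short b (<⇒≤ 1+n≤q))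
  ... | yes p = +-monoˡ-≤ 1 (≤-trans (∑-mono n none) (≤-reflexive (∑-zero n)))
    where
    none : ∀ {i} → i < n → 𝟙 (P? (b + i)) ≤ 0
    none {i} i<n with P? (b + i)
    ... | no _   = z≤n
    ... | yes p′ = contradiction (∣⇒≤ {{>-nonZero (m<n⇒0<n∸m i<n)}} (spaced p′ p″))
      (<⇒≱ (≤-<-trans (m∸n≤m n i) 1+n≤q))
      where
      p″ : P (b + i + (n ∸ i))
      p″ = subst P (sym (trans (+-assoc b i _) (cong (λ z → b + z) (m+[n∸m]≡n (<⇒≤ i<n))))) p

  count-blocks : ∀ t {s} → s ≤ q → ∑ (t * q + s) (𝟙 ∘ P?) ≤ suc t
  count-blocks zero    s≤q = count-short 0 s≤q
  count-blocks (suc t) {s} s≤q = begin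
    ∑ (q + t * q + s) (𝟙 ∘ P?)                     ≡⟨ cong (λ n → ∑ n (𝟙 ∘ P?)) (rearrange q (t * q) s) ⟩
    ∑ (t * q + s + q) (𝟙 ∘ P?)                     ≡⟨ ∑-split (t * q + s) q _ ⟩
    ∑ (t * q + s) (𝟙 ∘ P?) + ∑ q (λ i → 𝟙 (P? (t * q + s + i)))
      ≤⟨ +-mono-≤ (count-blocks t s≤q) (count-short (t * q + s) ≤-refl) ⟩
    suc t + 1                                       ≡⟨ +-comm (suc t) 1 ⟩
    suc (suc t)                                     ∎
    where
    open ≤-Reasoning
    rearrange : ∀ a b c → a + b + c ≡ b + c + a
    rearrange = ℕ-Solver.solve-∀

  -- An initial segment consists of n / q full blocks and a shorter one of length n % q, each with
  -- at most one hit.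
  count≤ : ∀ n → ∑ n (𝟙 ∘ P?) ≤ suc (n / q)
  count≤ n = subst (λ m → ∑ m (𝟙 ∘ P?) ≤ suc (n / q))
    (trans (+-comm (n / q * q) (n % q)) (sym (m≡m%n+[m/n]*n n q)))
    (count-blocks (n / q) (<⇒≤ (m%n<n n q)))

-- 1/2² + … + 1/L² ≤ 3/4 - 1/L for L = n + 2, by telescoping.
∑-inverse-squares : ∀ X n →
  4 * (2 + n) * ∑ (suc n) (λ i → X / ((2 + i) * (2 + i))) ≤ X * (3 * n + 2)
∑-inverse-squares X zero    = begin
  4 * 2 * (0 + X / 4) ≡⟨ e (X / 4) ⟩
  X / 4 * 4 * 2       ≤⟨ *-monoˡ-≤ 2 (m/n*n≤m X 4) ⟩
  X * 2               ∎
  where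
  open ≤-Reasoning
  e : ∀ x → 4 * 2 * (0 + x) ≡ x * 4 * 2
  e = ℕ-Solver.solve-∀
∑-inverse-squares X (suc n) = *-cancelˡ-≤ (2 + n) (begin
  (2 + n) * (4 * (3 + n) * (T + t))                  ≡⟨ e₁ n T t ⟩
  (3 + n) * (4 * (2 + n) * T) + 4 * (2 + n) * (3 + n) * t
    ≤⟨ +-mono-≤ (*-monoʳ-≤ (3 + n) (∑-inverse-squares X n)) last-term ⟩
  (3 + n) * (X * (3 * n + 2)) + 4 * X                ≡⟨ e₂ n X ⟩
  (2 + n) * (X * (3 * suc n + 2))                    ∎)
  where
  open ≤-Reasoning
  T t : ℕ
  T = ∑ (suc n) (λ i → X / ((2 + i) * (2 + i)))
  t = X / ((3 + n) * (3 + n))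
  e₁ : ∀ n T t → (2 + n) * (4 * (3 + n) * (T + t)) ≡ (3 + n) * (4 * (2 + n) * T) + 4 * (2 + n) * (3 + n) * t
  e₁ = ℕ-Solver.solve-∀
  e₂ : ∀ n X → (3 + n) * (X * (3 * n + 2)) + 4 * X ≡ (2 + n) * (X * (3 * suc n + 2))
  e₂ = ℕ-Solver.solve-∀
  e₃ : ∀ n t → 4 * (3 + n) * (3 + n) * t ≡ 4 * (t * ((3 + n) * (3 + n)))
  e₃ = ℕ-Solver.solve-∀
  -- The telescoping estimate 1/(3 + n)² ≤ 1/(2 + n) - 1/(3 + n), cleared of denominators.
  last-term : 4 * (2 + n) * (3 + n) * t ≤ 4 * X
  last-term = begin
    4 * (2 + n) * (3 + n) * t     ≤⟨ *-monoˡ-≤ t (*-monoˡ-≤ (3 + n) (*-monoʳ-≤ 4 (n≤1+n (2 + n)))) ⟩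
    4 * (3 + n) * (3 + n) * t     ≡⟨ e₃ n t ⟩
    4 * (t * ((3 + n) * (3 + n))) ≤⟨ *-monoʳ-≤ 4 (m/n*n≤m X _) ⟩
    4 * X                         ∎

suc-coprime : ∀ n → ℕ.Coprime n (suc n)
suc-coprime n {d} (d∣n , d∣1+n) = ∣1⇒≡1 (∣m+n∣m⇒∣n (subst (d ∣_) (+-comm 1 n) d∣1+n) d∣n)

coprime-∣ʳ : ∀ {m n o} → o ∣ n → ℕ.Coprime m n → ℕ.Coprime m o
coprime-∣ʳ o∣n m⊥n (d∣m , d∣o) = m⊥n (d∣m , ∣-trans d∣o o∣n)

coprime-*ʳ : ∀ {m n o} → ℕ.Coprime m n → ℕ.Coprime m o → ℕ.Coprime m (n * o)
coprime-*ʳ m⊥n m⊥o {d} (d∣m , d∣no) =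
  m⊥o (d∣m , ℕ.coprime-divisor (λ (e∣d , e∣n) → m⊥n (∣-trans e∣d d∣m , e∣n)) d∣no)

coprime-squares : ∀ {m n} → ℕ.Coprime m n → ℕ.Coprime (m * m) (n * n)
coprime-squares m⊥n = ℕ.sym (coprime-*ʳ n²⊥m n²⊥m)
  where
  n²⊥m = ℕ.sym (coprime-*ʳ m⊥n m⊥n)

coprime-progression : ∀ {c M} → ℕ.Coprime c M → ∀ j → ℕ.Coprime (c + M * j) M
coprime-progression {c} {M} c⊥M j {d} (d∣c+Mj , d∣M) =
  c⊥M (∣m+n∣m⇒∣n (subst (d ∣_) (+-comm c (M * j)) d∣c+Mj) (∣-trans d∣M (m∣m*n j)) , d∣M)

-- If each of the first X = 4L terms, where L = 4M + c, had a square divisor k² > 1,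
-- then k ≤ L, and double counting would give X ≤ ∑ (X/k² + 1) < 3X/4 + L = X.
squarefree-term : ∀ c M .{{_ : NonZero c}} .{{_ : NonZero M}} → ℕ.Coprime c M →
  ∃ λ j → Squarefree (+ (c + M * j))
squarefree-term c M c⊥M = go
  where
  open ≤-Reasoning
  -- Subtracting 2 first makes L equal to `2 + w` by definition, so k = 2 + i with i < `suc w` runs
  -- exactly over 2, ..., L.
  w : ℕ
  w = 4 * M + c ∸ 2
  L X : ℕ
  L = 2 + w
  X = 4 * L

  L≡ : L ≡ 4 * M + c
  L≡ = m+[n∸m]≡n (≤-trans (≤-trans (s≤s (s≤s z≤n)) (*-monoʳ-≤ 4 (>-nonZero⁻¹ M))) (m≤m+n (4 * M) c))

  a : ℕ → ℕ
  a j = c + M * j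

  -- The choice L = 4M + c is made for this bound: c + 4ML ≤ (4M + c)L.
  a≤L² : ∀ {j} → j < X → a j ≤ L * L
  a≤L² {j} j<X = begin
    c + M * j              ≤⟨ +-monoʳ-≤ c (*-monoʳ-≤ M (<⇒≤ j<X)) ⟩
    c + M * (4 * L)        ≤⟨ +-monoˡ-≤ _ (m≤m*n c L) ⟩
    c * L + M * (4 * L)    ≡⟨ e c M L ⟩
    (4 * M + c) * L        ≡⟨ cong (_* L) L≡ ⟨
    L * L                  ∎
    where
    e : ∀ c M L → c * L + M * (4 * L) ≡ (4 * M + c) * L
    e = ℕ-Solver.solve-∀

  sq : ℕ → ℕ
  sq i = (2 + i) * (2 + i)

  bad? : ∀ i j → Dec (sq i ∣ a j)
  bad? i j = sq i ∣? a j

  -- A divisor of a term is coprime to M, so M can be cancelled from the difference M l of two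
  -- terms.
  spaced : ∀ i {j l} → sq i ∣ a j → sq i ∣ a (j + l) → sq i ∣ l
  spaced i {j} {l} i∣aj i∣ajl = ℕ.coprime-divisor {n = M}
    (λ (d∣i² , d∣M) → coprime-progression c⊥M j (∣-trans d∣i² i∣aj , d∣M))
    (∣m+n∣m⇒∣n (subst (sq i ∣_) (e c M j l) i∣ajl) i∣aj)
    where
    e : ∀ c M j l → c + M * (j + l) ≡ c + M * j + M * l
    e = ℕ-Solver.solve-∀

  not-all-bad : ¬ (∀ {j} → j < X → ∃ λ i → i < suc w × sq i ∣ a j)
  -- There are only L - 1 = `suc w` values of k, and this makes the comparison with X = 4L strict.
  not-all-bad all-bad = <⇒≱ {4 * suc w} {X} (*-monoʳ-< 4 (n<1+n (suc w))) (+-cancelˡ-≤ (3 * X) _ _ (begin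
    3 * X + X              ≡⟨ +-comm (3 * X) X ⟩
    4 * X                  ≤⟨ *-monoʳ-≤ 4 X≤ ⟩
    4 * (T + suc w)        ≡⟨ *-distribˡ-+ 4 T (suc w) ⟩
    4 * T + 4 * suc w      ≤⟨ +-monoˡ-≤ _ 4T≤3X ⟩
    3 * X + 4 * suc w      ∎))
    where
    T : ℕ
    T = ∑ (suc w) (λ i → X / sq i)

    X≤ : X ≤ T + suc w
    X≤ = begin
      X                                            ≡⟨ ∑-1 X ⟨
      ∑ X (λ _ → 1)                                ≤⟨ ∑-mono X counted ⟩
      ∑ X (λ j → ∑ (suc w) (λ i → 𝟙 (bad? i j)))   ≡⟨ ∑-comm X (suc w) _ ⟩
      ∑ (suc w) (λ i → ∑ X (λ j → 𝟙 (bad? i j)))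
        ≤⟨ ∑-mono (suc w) (λ {i} _ → Count.count≤ (bad? i) (sq i) (spaced i) X) ⟩
      ∑ (suc w) (λ i → 1 + X / sq i)               ≡⟨ ∑-+ (suc w) (λ _ → 1) (λ i → X / sq i) ⟩
      ∑ (suc w) (λ _ → 1) + T                      ≡⟨ cong (_+ T) (∑-1 (suc w)) ⟩
      suc w + T                                    ≡⟨ +-comm (suc w) T ⟩
      T + suc w                                    ∎
      where
      counted : ∀ {j} → j < X → 1 ≤ ∑ (suc w) (λ i → 𝟙 (bad? i j))
      counted {j} j<X = let i , i<w , i∣ = all-bad j<X in
        ≤-trans (1≤𝟙 (bad? i j) i∣) (term≤∑ (suc w) (λ i → 𝟙 (bad? i j)) i<w)

    4T≤3X : 4 * T ≤ 3 * X
    4T≤3X = *-cancelˡ-≤ L (begin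
      L * (4 * T)      ≡⟨ e₁ L T ⟩
      4 * L * T        ≤⟨ ∑-inverse-squares X w ⟩
      X * (3 * w + 2)  ≤⟨ *-monoʳ-≤ X (+-monoʳ-≤ (3 * w) (s≤s (s≤s z≤n))) ⟩
      X * (3 * w + 6)  ≡⟨ e₂ X w ⟩
      L * (3 * X)      ∎)
      where
      e₁ : ∀ L T → L * (4 * T) ≡ 4 * L * T
      e₁ = ℕ-Solver.solve-∀
      e₂ : ∀ X w → X * (3 * w + 6) ≡ (2 + w) * (3 * X)
      e₂ = ℕ-Solver.solve-∀

  squarefree : ∀ {j} → j < X → ¬ (∃ λ i → i < suc w × sq i ∣ a j) → Squarefree (+ a j)
  squarefree {j} j<X good 0 0∣a = contradiction (m+n≡0⇒m≡0 c (0∣⇒≡0 0∣a)) (≢-nonZero⁻¹ c)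
  squarefree {j} j<X good 1 _ = refl
  squarefree {j} j<X good k@(suc (suc i)) k²∣a with i <? suc w
  ... | yes i<w = contradiction (i , i<w , k²∣a) good
  -- Here k > L, so k² exceeds the term.
  ... | no i≮w  = contradiction
    (≤-trans (∣⇒≤ {{>-nonZero (≤-trans (>-nonZero⁻¹ c) (m≤m+n c _))}} k²∣a) (a≤L² j<X)) (<⇒≱ (*-mono-< L<k L<k))
    where
    L<k : L < k
    L<k = s≤s (s≤s (≮⇒≥ i≮w))

  -- Both quantifiers are bounded and decidable, so a search turns the counting contradiction into a
  -- witness.
  go : ∃ λ j → Squarefree (+ a j)
  go with anyUpTo? (λ j → ¬? (anyUpTo? (λ i → bad? i j) (suc w))) X
  ... | yes (j , j<X , good) = j , squarefree j<X good
  ... | no none = contradiction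
    (λ {j} j<X → decidable-stable (anyUpTo? (λ i → bad? i j) (suc w)) (λ good → none (j , j<X , good)))
    not-all-bad

opaque
  -- Starting the progression `suc K` steps later puts every term above K and makes the first term
  -- nonzero.
  squarefree-term≥ : ∀ c M .{{_ : NonZero M}} → ℕ.Coprime c M → ∀ K →
    ∃ λ j → K < c + M * j × Squarefree (+ (c + M * j))
  squarefree-term≥ c M c⊥M K =
    let j , sf = squarefree-term c′ M {{>-nonZero (≤-<-trans z≤n K<c′)}} (coprime-progression c⊥M (suc K)) in
    suc K + j ,
    subst (λ a → K < a × Squarefree (+ a)) (e c M (suc K) j) (<-≤-trans K<c′ (m≤m+n c′ _) , sf)
    where
    c′ : ℕ
    c′ = c + M * suc K
    K<c′ : K < c′
    K<c′ = ≤-trans (m≤n*m (suc K) M) (m≤n+m _ c)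
    e : ∀ c M k j → c + M * k + M * j ≡ c + M * (k + j)
    e = ℕ-Solver.solve-∀

primeDivisor : ∀ n → n ≢ 1 → ∃ λ q → Prime q × q ∣ n
primeDivisor zero _ = 2 , prime[2] , 2 ∣0
primeDivisor n@(suc _) n≢1 with factorise n
... | record { factors = [] ; isFactorisation = n≡1 } = contradiction n≡1 n≢1
... | record { factors = q ∷ qs ; isFactorisation = n≡ ; factorsPrime = q-prime ∷ _ } =
  q , q-prime , divides (product qs) (trans n≡ (*-comm q _))

prime∤⇒coprime : ∀ {q n} → Prime q → ¬ (q ∣ n) → ℕ.Coprime q n
prime∤⇒coprime q-prime q∤n (d∣q , d∣n) with prime⇒irreducible q-prime d∣q
... | inj₁ d≡1  = d≡1
... | inj₂ refl = contradiction d∣n q∤n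

-- A prime q with q² dividing a b fails to divide one of the coprime factors, so q² divides the
-- other.
squarefree-* : ∀ a b → ℕ.Coprime ∣ a ∣ ∣ b ∣ → Squarefree a → Squarefree b → Squarefree (a ℤ.* b)
squarefree-* a b a⊥b sf-a sf-b n n²∣ab with n ≟ 1
... | yes n≡1 = n≡1
... | no n≢1 with q , q-prime , q∣n ← primeDivisor n n≢1 = ⊥-elim (absurd (q ∣? ∣ a ∣))
  where
  q²∣ab : q * q ∣ ∣ a ∣ * ∣ b ∣
  q²∣ab = subst (q * q ∣_) (ℤ.abs-* a b) (∣-trans (*-pres-∣ q∣n q∣n) n²∣ab)
  q≢1 : q ≢ 1
  q≢1 refl = ¬prime[1] q-prime
  q²⊥ : ∀ {m} → ¬ (q ∣ m) → ℕ.Coprime (q * q) m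
  q²⊥ q∤m = ℕ.sym (coprime-*ʳ q⊥m q⊥m)
    where q⊥m = ℕ.sym (prime∤⇒coprime q-prime q∤m)
  absurd : Dec (q ∣ ∣ a ∣) → ⊥
  absurd (no q∤a)  = q≢1 (sf-b q (ℕ.coprime-divisor (q²⊥ q∤a) q²∣ab))
  absurd (yes q∣a) = q≢1 (sf-a q (ℕ.coprime-divisor (q²⊥ λ q∣b → q≢1 (a⊥b (q∣a , q∣b)))
    (subst (q * q ∣_) (*-comm ∣ a ∣ ∣ b ∣) q²∣ab)))

-- Squarefree parts of integers

fromℤ-* : ∀ i j → fromℤ (i ℤ.* j) ≡ fromℤ i ℚ.* fromℤ j
fromℤ-* i j = ℚ.toℚᵘ-injective (ℚᵘ.≃-sym (ℚ.toℚᵘ-homo-* (fromℤ i) (fromℤ j)))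

fromℤ-injective : ∀ {i j} → fromℤ i ≡ fromℤ j → i ≡ j
fromℤ-injective = cong ℚ.numerator

clearDenominator : ∀ q → q ℚ.* fromℤ (ℚ.↧ q) ≡ fromℤ (ℚ.↥ q)
clearDenominator q@record{} = ℚ.toℚᵘ-injective
  (ℚᵘ.≃-trans (ℚ.toℚᵘ-homo-* q (fromℤ (ℚ.↧ q))) (ℚᵘ.*≡* (e (ℚ.↥ q) (ℚ.↧ q))))
  where
  e : ∀ u v → u ℤ.* v ℤ.* 1ℤ ≡ u ℤ.* (v ℤ.* 1ℤ)
  e = ℤ-Solver.solve-∀

-- In lowest terms, the denominator of s is 1 because its square divides d.
squarefreePart≤ : ∀ {d a} → a ≢ 0ℤ → IsSquarefreePart d (fromℤ a) → ∣ d ∣ ≤ ∣ a ∣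
squarefreePart≤ {d} {a} a≢0 (sf , s@(mkℚ u v-1 u⊥v) , a≡ds²) =
  ∣⇒≤ {{≢-nonZero (a≢0 ∘ ℤ.∣i∣≡0⇒i≡0)}} (divides (∣ u ∣ * ∣ u ∣) (trans (sym ∣a∣≡) (*-comm ∣ d ∣ _)))
  where
  v : ℕ
  v = suc v-1
  av²≡du² : a ℤ.* + v ℤ.* + v ≡ d ℤ.* (u ℤ.* u)
  av²≡du² = fromℤ-injective (begin
    fromℤ (a ℤ.* + v ℤ.* + v)                  ≡⟨ fromℤ-* (a ℤ.* + v) (+ v) ⟩
    fromℤ (a ℤ.* + v) ℚ.* V                    ≡⟨ cong (ℚ._* V) (fromℤ-* a (+ v)) ⟩
    fromℤ a ℚ.* V ℚ.* V                        ≡⟨ cong (λ z → z ℚ.* V ℚ.* V) a≡ds² ⟩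
    fromℤ d ℚ.* (s ℚ.* s) ℚ.* V ℚ.* V          ≡⟨ e (fromℤ d) s V ⟩
    fromℤ d ℚ.* ((s ℚ.* V) ℚ.* (s ℚ.* V))      ≡⟨ cong (λ z → fromℤ d ℚ.* (z ℚ.* z)) (clearDenominator s) ⟩
    fromℤ d ℚ.* (fromℤ u ℚ.* fromℤ u)          ≡⟨ cong (fromℤ d ℚ.*_) (fromℤ-* u u) ⟨
    fromℤ d ℚ.* fromℤ (u ℤ.* u)                ≡⟨ fromℤ-* d (u ℤ.* u) ⟨
    fromℤ (d ℤ.* (u ℤ.* u))                    ∎)
    where
    open ≡-Reasoning
    V = fromℤ (+ v)
    e : ∀ d s V → d ℚ.* (s ℚ.* s) ℚ.* V ℚ.* V ≡ d ℚ.* ((s ℚ.* V) ℚ.* (s ℚ.* V))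
    e = ℚ-Solver.solve-∀ ℚ-ring

  ∣av²∣≡∣du²∣ : ∣ a ∣ * (v * v) ≡ ∣ d ∣ * (∣ u ∣ * ∣ u ∣)
  ∣av²∣≡∣du²∣ = begin
    ∣ a ∣ * (v * v)           ≡⟨ *-assoc ∣ a ∣ v v ⟨
    ∣ a ∣ * v * v             ≡⟨ cong (_* v) (ℤ.abs-* a (+ v)) ⟨
    ∣ a ℤ.* + v ∣ * v         ≡⟨ ℤ.abs-* (a ℤ.* + v) (+ v) ⟨
    ∣ a ℤ.* + v ℤ.* + v ∣     ≡⟨ cong ∣_∣ av²≡du² ⟩
    ∣ d ℤ.* (u ℤ.* u) ∣       ≡⟨ ℤ.abs-* d (u ℤ.* u) ⟩
    ∣ d ∣ * ∣ u ℤ.* u ∣       ≡⟨ cong (∣ d ∣ *_) (ℤ.abs-* u u) ⟩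
    ∣ d ∣ * (∣ u ∣ * ∣ u ∣)   ∎
    where open ≡-Reasoning

  v≡1 : v ≡ 1
  v≡1 = sf v (ℕ.coprime-divisor {n = ∣ u ∣ * ∣ u ∣}
    (ℕ.sym (coprime-squares (ℕ.recompute u⊥v)))
    (divides ∣ a ∣ (trans (*-comm (∣ u ∣ * ∣ u ∣) ∣ d ∣) (sym ∣av²∣≡∣du²∣))))

  ∣a∣≡ : ∣ d ∣ * (∣ u ∣ * ∣ u ∣) ≡ ∣ a ∣
  ∣a∣≡ = trans (sym ∣av²∣≡∣du²∣) (trans (cong (λ z → ∣ a ∣ * (z * z)) v≡1) (*-identityʳ ∣ a ∣))

-- Squarefree integers in prescribed residue classes

opaque
  -- The residue M - 1 is coprime to M. Since `-[1+ n ]` is -(n + 1), the divisibility says that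
  -- `-[1+ n ]` is 1 modulo M; this supplies the negative d₂.
  squarefree≡-1 : ∀ M .{{_ : NonZero M}} → ∃ λ n → M ∣ 2 + n × Squarefree (+ suc n)
  squarefree≡-1 M@(suc M′) with squarefree-term≥ M′ M (suc-coprime M′) 0
  ... | j , 0<a , sf with M′ + M * j in eq
  ... | suc n = n , divides (suc j) (trans (cong suc (sym eq)) (cong (λ z → M + z) (*-comm M j))) , sf

squarefree-1 : Squarefree 1ℤ
squarefree-1 n n²∣1 = m*n≡1⇒m≡1 n n (∣1⇒≡1 n²∣1)

-- The progression starts at the least nonnegative residue of m, which is again coprime to p.
squarefree≡ : ∀ {m p} .{{_ : NonZero p}} → ℕ.Coprime ∣ m ∣ p → ∀ K →
  ∃ λ d → K < d × Squarefree (+ d) × + d ≡ m [mod p ]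
squarefree≡ {m} {p} m⊥p K =
  let j , K<d , sf = squarefree-term≥ c p c⊥p K in
  c + p * j , K<d , sf , Signed.∣⇒∣ᵤ (Signed.divides (+ j ℤ.- q) (difference j))
  where
  c : ℕ
  c = m ℤ.%ℕ p
  q : ℤ
  q = m ℤ./ℕ p
  m≡ : m ≡ + c ℤ.+ q ℤ.* + p
  m≡ = ℤ.a≡a%ℕn+[a/ℕn]*n m p
  c⊥p : ℕ.Coprime c p
  c⊥p {e} (e∣c , e∣p) = m⊥p (Signed.∣⇒∣ᵤ {+ e} {m} (subst (+ e Signed.∣_) (sym m≡)
    (Signed.∣m∣n⇒∣m+n (Signed.∣ᵤ⇒∣ {+ e} {+ c} e∣c) (Signed.∣n⇒∣m*n q (Signed.∣ᵤ⇒∣ {+ e} {+ p} e∣p)))) , e∣p)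
  difference : ∀ j → + (c + p * j) ℤ.- m ≡ (+ j ℤ.- q) ℤ.* + p
  difference j = begin
    + (c + p * j) ℤ.- m                                  ≡⟨ cong (λ z → + c ℤ.+ z ℤ.- m) (ℤ.pos-* p j) ⟩
    + c ℤ.+ + p ℤ.* + j ℤ.- m                            ≡⟨ cong (λ z → + c ℤ.+ + p ℤ.* + j ℤ.- z) m≡ ⟩
    + c ℤ.+ + p ℤ.* + j ℤ.- (+ c ℤ.+ q ℤ.* + p)          ≡⟨ e (+ c) (+ p) (+ j) q ⟩
    (+ j ℤ.- q) ℤ.* + p                                  ∎
    where
    open ≡-Reasoning
    e : ∀ c p j q → c ℤ.+ p ℤ.* j ℤ.- (c ℤ.+ q ℤ.* p) ≡ (j ℤ.- q) ℤ.* p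
    e = ℤ-Solver.solve-∀

-- Conductors and quadratic characters

primeFactors-prime : ∀ n → All Prime (primeFactors n)
primeFactors-prime zero      = []
primeFactors-prime n@(suc _) = PrimeFactorisation.factorsPrime (factorise n)

primeFactors-∣ : ∀ n {q} → q ∈ primeFactors n → q ∣ n
primeFactors-∣ n@(suc _) {q} q∈ =
  subst (q ∣_) (sym (PrimeFactorisation.isFactorisation (factorise n))) (∈⇒∣product q∈)

-- The conductor is a product of powers of primes, whatever exponents Tate's algorithm returns.
conductor-nonZero : ∀ E → NonZero (conductor E)
conductor-nonZero E = product≢0 (All.map⁺ (All.tabulate λ {p} p∈ →
  m^n≢0 p (Tate.conductorExponent p (integralModel E))
    {{prime⇒nonZero (All.lookup (primeFactors-prime n) (∈-deduplicate⁻ _≟_ (primeFactors n) p∈))}}))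
  where
  n : ℕ
  n = ∣ Weierstrass.Δ (integralModel E) ∣

∤-pred : ∀ {q n} → q ≢ 1 → q ∣ suc n → ¬ (q ∣ n)
∤-pred q≢1 q∣1+n q∣n = q≢1 (suc-coprime _ (q∣n , q∣1+n))

fundamentalDiscriminant-1mod4 : ∀ j → 4 ∣ 2 + j → fundamentalDiscriminant -[1+ j ] ≡ -[1+ j ]
fundamentalDiscriminant-1mod4 j 4∣2+j
  -- `∣ -[1+ j ] ℤ.- 1ℤ ∣` computes to `2 + (j + 0)`.
  rewrite +-identityʳ j | dec-true (4 ∣? 2 + j) 4∣2+j = refl

-- The square x² with x = 1 is found among the residues.
kroneckerPrime≡1 : ∀ j {q} → Prime q → 8 ∣ 2 + j → q ∣ 2 + j → kroneckerPrime -[1+ j ] q ≡ 1ℤ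
kroneckerPrime≡1 j {0} q-prime _ _ = contradiction q-prime ¬prime[0]
kroneckerPrime≡1 j {1} q-prime _ _ = contradiction q-prime ¬prime[1]
kroneckerPrime≡1 j {2} q-prime 8∣2+j 2∣2+j
  rewrite +-identityʳ j | dec-false (2 ∣? suc j) (∤-pred (λ ()) 2∣2+j) | dec-true (8 ∣? 2 + j) 8∣2+j = refl
kroneckerPrime≡1 j {q@(suc (suc (suc m)))} q-prime _ q∣2+j
  rewrite +-identityʳ j | dec-false (q ∣? suc j) (∤-pred (λ ()) q∣2+j) | dec-true (q ∣? 2 + j) q∣2+j = refl

-- The discriminant is 1 modulo 8 and modulo every prime factor of N, so each prime contributes 1.
-- The sign comes from `kroneckerUnit`, as the discriminant is negative.
χ≡-1 : ∀ N j .{{_ : NonZero N}} → 8 * N ∣ 2 + j → χ -[1+ j ] (ℤ.- + N) ≡ -1ℤ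
χ≡-1 N@(suc _) j 8N∣2+j
  rewrite fundamentalDiscriminant-1mod4 j (∣-trans (∣-trans (divides 2 refl) (m∣m*n N)) 8N∣2+j)
  = cong (-1ℤ ℤ.*_) (all-1 (All.tabulate λ {q} q∈ → kroneckerPrime≡1 j
      (All.lookup (primeFactors-prime N) q∈) (∣-trans (m∣m*n N) 8N∣2+j)
      (∣-trans (primeFactors-∣ N q∈) (∣-trans (n∣m*n 8) 8N∣2+j))))
  where
  all-1 : ∀ {D qs} → All (λ q → kroneckerPrime D q ≡ 1ℤ) qs →
    foldr ℤ._*_ 1ℤ (List.map (kroneckerPrime D) qs) ≡ 1ℤ
  all-1 []       = refl
  all-1 (e ∷ es) = cong₂ ℤ._*_ e (all-1 es)

-- Twists and values of the quartic

module _ (E : EllipticCurve) (d : ℤ) where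
  open Twist E d

  combination-first : ∀ {r} (P : Fin (suc r) → Point) n →
    combination (λ { zero → n ; (suc _) → 0ℤ }) P ≡ n · P zero ⊕ O
  combination-first {zero}  P n = refl
  combination-first {suc r} P n = combination-first {r} (λ { zero → P zero ; (suc i) → P (suc (suc i)) }) n

  independent⇒nontorsion : ∀ {r} (P : Fin (suc r) → Point) → Independent P →
    ∀ n → n · P zero ≡ O → n ≡ 0ℤ
  independent⇒nontorsion P ind n nP≡O =
    ind (λ { zero → n ; (suc _) → 0ℤ }) (trans (combination-first P n) (cong (_⊕ O) nP≡O)) zero

  2-torsion : ∀ x → (+ 2) · ⟨ x , 0ℚ ⟩ ≡ O
  -- The second test in `_⊕_`, comparing 0 with - 0, evaluates to `yes` by itself.
  2-torsion x with x ℚ.≟ x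
  ... | yes _  = refl
  ... | no x≢x = contradiction refl x≢x

  -- `O` is killed by 1 and a point with y = 0 by 2.
  nontorsion⇒y≢0 : ∀ Q → OnCurve Q → (∀ n → n · Q ≡ O → n ≡ 0ℤ) →
    ∃₂ λ x y → y ≢ 0ℚ × OnCurve ⟨ x , y ⟩
  nontorsion⇒y≢0 O         _  nontorsion = contradiction (nontorsion (+ 1) refl) λ ()
  nontorsion⇒y≢0 ⟨ x , y ⟩ on nontorsion =
    x , y , (λ { refl → contradiction (nontorsion (+ 2) (2-torsion x)) λ () }) , on

  nontorsion-point : ∀ {r} → HasRank (suc r) →
    ∃₂ λ x y → y ≢ 0ℚ × OnCurve ⟨ x , y ⟩
  nontorsion-point (P , on , ind , _) =
    nontorsion⇒y≢0 (P zero) (on zero) (independent⇒nontorsion P ind)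

  -- The empty combination is `O`, so rank 0 makes every point torsion, whereas the first member of
  -- a nonempty independent family is not.
  rank0-unique : ∀ {r} → HasRank 0 → HasRank r → r ≡ 0
  rank0-unique {zero}  _ _ = refl
  rank0-unique {suc r} (_ , _ , _ , torsion) (P , on , ind , _) =
    let k , _ , k≢0 , kP≡O = torsion (P zero) (on zero) in
    contradiction (independent⇒nontorsion P ind k kP≡O) k≢0

∣∈∣≤sum : ∀ {x xs} → x ∈ xs → ∣ x ∣ ≤ sum (List.map ∣_∣ xs)
∣∈∣≤sum (here refl) = m≤m+n _ _
∣∈∣≤sum (there x∈)  = ≤-trans (∣∈∣≤sum x∈) (m≤n+m _ _)

coprime-1 : ∀ i → ℤ.Coprime 1ℤ i
coprime-1 i = ℕ.1-coprimeTo ∣ i ∣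

fundamentalDiscriminant-1-coprime : ∀ i → ℤ.Coprime (fundamentalDiscriminant 1ℤ) i
fundamentalDiscriminant-1-coprime = coprime-1

module _ {N n} (8N∣2+n : 8 * N ∣ 2 + n) where
  coprime-2N : ℤ.Coprime -[1+ n ] (+ 2 ℤ.* + N)
  coprime-2N = coprime-∣ʳ (subst (_∣ 2 + n) (sym (ℤ.abs-* (+ 2) (+ N)))
    (∣-trans (*-monoˡ-∣ N (divides {2} {8} 4 refl)) 8N∣2+n)) (suc-coprime (suc n))

  fundamentalDiscriminant-coprime : ℤ.Coprime (fundamentalDiscriminant -[1+ n ]) (+ N)
  fundamentalDiscriminant-coprime = subst (λ D → ℤ.Coprime D (+ N))
    (sym (fundamentalDiscriminant-1mod4 n (∣-trans (divides 2 refl) (∣-trans (m∣m*n N) 8N∣2+n))))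
    (coprime-∣ʳ (∣-trans (n∣m*n 8) 8N∣2+n) (suc-coprime (suc n)))

module _ (E : EllipticCurve) where
  -- Uniqueness of rank 0 forces r = 0, and then r′ = 0 would give 1 = -1. The sign is a variable ε
  -- so that matching on `refl` can replace it by -1.
  odd-rank : ∀ {d ε} → Twist.HasRank E 1ℤ 0 → ε ≡ -1ℤ →
    (∃₂ λ r r′ → Twist.HasRank E 1ℤ r × Twist.HasRank E d r′ × -1ℤ ℤ.^ r′ ≡ -1ℤ ℤ.^ r ℤ.* ε) →
    ∃ λ r → Twist.HasRank E d (suc r)
  odd-rank rank-0 ε≡-1 (_ , suc r′ , _ , rank′ , _) = r′ , rank′
  odd-rank rank-0 refl (_ , zero , rank , _ , sign) with refl ← rank0-unique E 1ℤ rank-0 rank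
    with () ← sign

  module _ (parity : ParityConjecture) where
    -- The case d = 1 extracts the Mordell-Weil theorem from the conjecture.
    rank-exists : ∃ (Twist.HasRank E 1ℤ)
    rank-exists = let r , _ , rank , _ = parity E 1ℤ squarefree-1 (coprime-1 (+ 2 ℤ.* + conductor E))
                                           (fundamentalDiscriminant-1-coprime (+ conductor E)) in r , rank

    odd-twist : Twist.HasRank E 1ℤ 0 → ∀ n → Squarefree -[1+ n ] → 8 * conductor E ∣ 2 + n →
      ∃ λ r → Twist.HasRank E -[1+ n ] (suc r)
    odd-twist rank-0 n sf 8N∣2+n = odd-rank rank-0 (χ≡-1 (conductor E) n {{conductor-nonZero E}} 8N∣2+n)
      (parity E -[1+ n ] sf (coprime-2N {conductor E} 8N∣2+n)
        (fundamentalDiscriminant-coprime {conductor E} 8N∣2+n))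

module _ (a b c d : ℚ) (e : ℤ) (e≢0 : fromℤ e ≢ 0ℚ)
  (d≢0 : d ≢ 0ℚ) (disc≢0 : discriminant a b c d ≢ 0ℚ) where
  private
    E : EllipticCurve
    E = reversedCurve (fromℤ e) a b c d e≢0 d≢0 disc≢0

  -- Dividing δ y² = e G(x) by e gives G(x) = δ e (y/e)², so t = y/e.
  twist-value : ∀ δ {r} → Twist.HasRank E δ (suc r) →
    ∃₂ λ x t → t ≢ 0ℚ × a ℚ.+ x ℚ.* (b ℚ.+ x ℚ.* (c ℚ.+ x ℚ.* d)) ≡ fromℤ (δ ℤ.* e) ℚ.* (t ℚ.* t)
  twist-value δ rank with x , y , y≢0 , on ← nontorsion-point E δ rank = x , i ℚ.* y ,
    *-≢0 {i} i≢0 y≢0 , (begin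
    G                                                  ≡⟨ e₁ G ⟨
    G ℚ.* 1ℚ ℚ.* 1ℚ                                    ≡⟨ cong (λ z → G ℚ.* z ℚ.* z) ie≡1 ⟨
    G ℚ.* (i ℚ.* ε) ℚ.* (i ℚ.* ε)                      ≡⟨ e₂ ε i G ⟩
    ε ℚ.* G ℚ.* (i ℚ.* i ℚ.* ε)
      ≡⟨ cong (ℚ._* (i ℚ.* i ℚ.* ε)) (trans on (evalℚ-scale ε a b c d x)) ⟨
    fromℤ δ ℚ.* (y ℚ.* y) ℚ.* (i ℚ.* i ℚ.* ε)          ≡⟨ e₃ (fromℤ δ) ε i y ⟩
    fromℤ δ ℚ.* ε ℚ.* ((i ℚ.* y) ℚ.* (i ℚ.* y))        ≡⟨ cong (ℚ._* ((i ℚ.* y) ℚ.* (i ℚ.* y))) (fromℤ-* δ e) ⟨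
    fromℤ (δ ℤ.* e) ℚ.* ((i ℚ.* y) ℚ.* (i ℚ.* y))      ∎)
    where
    open ≡-Reasoning
    ε i G : ℚ
    ε = fromℤ e
    i = proj₁ (inverse e≢0)
    G = a ℚ.+ x ℚ.* (b ℚ.+ x ℚ.* (c ℚ.+ x ℚ.* d))
    ie≡1 : i ℚ.* ε ≡ 1ℚ
    ie≡1 = proj₂ (inverse e≢0)
    i≢0 : i ≢ 0ℚ
    i≢0 i≡0 = contradiction (trans (sym ie≡1) (trans (cong (ℚ._* ε) i≡0) (ℚ.*-zeroˡ ε))) λ ()
    e₁ : ∀ G → G ℚ.* 1ℚ ℚ.* 1ℚ ≡ G
    e₁ = ℚ-Solver.solve-∀ ℚ-ring
    e₂ : ∀ ε i G → G ℚ.* (i ℚ.* ε) ℚ.* (i ℚ.* ε) ≡ ε ℚ.* G ℚ.* (i ℚ.* i ℚ.* ε)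
    e₂ = ℚ-Solver.solve-∀ ℚ-ring
    e₃ : ∀ δ ε i y → δ ℚ.* (y ℚ.* y) ℚ.* (i ℚ.* i ℚ.* ε) ≡ δ ℚ.* ε ℚ.* ((i ℚ.* y) ℚ.* (i ℚ.* y))
    e₃ = ℚ-Solver.solve-∀ ℚ-ring

-- Separable quartics with a rational root

quarticPolynomial : ∀ (a₀ a₁ a₂ a₃ a₄ : ℤ) → a₄ ≢ 0ℤ → Polynomial 4
quarticPolynomial a₀ a₁ a₂ a₃ a₄ a₄≢0 =
  record { coeffs = a₀ ∷ a₁ ∷ a₂ ∷ a₃ ∷ a₄ ∷ [] ; leading≢0 = a₄≢0 }

module QuarticWithRoot (a₀ a₁ a₂ a₃ a₄ : ℤ) (a₄≢0 : a₄ ≢ 0ℤ)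
  (separable : Separable (quarticPolynomial a₀ a₁ a₂ a₃ a₄ a₄≢0))
  (r : ℚ) (root : ⟦ quarticPolynomial a₀ a₁ a₂ a₃ a₄ a₄≢0 ⟧ r ≡ 0ℚ) where

  open Shift (fromℤ a₀) (fromℤ a₁) (fromℤ a₂) (fromℤ a₃) (fromℤ a₄) r

  private
    f : Polynomial 4
    f = quarticPolynomial a₀ a₁ a₂ a₃ a₄ a₄≢0
    u v : ℚ → ℚ
    u = evalℚ (proj₁ separable)
    v = evalℚ (proj₁ (proj₂ separable))

  derivative≡ : ∀ x → evalℤ (derivative (a₀ ∷ a₁ ∷ a₂ ∷ a₃ ∷ a₄ ∷ [])) x ≡ quartic′ x
  derivative≡ x
    rewrite ℤ.*-identityˡ a₁ | fromℤ-* (+ 2) a₂ | fromℤ-* (+ 3) a₃ | fromℤ-* (+ 4) a₄ = refl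

  unit : ∀ x → u x ℚ.* quartic x ℚ.+ v x ℚ.* quartic′ x ≡ 1ℚ
  unit x = subst (λ y → u x ℚ.* quartic x ℚ.+ v x ℚ.* y ≡ 1ℚ) (derivative≡ x) (proj₂ (proj₂ separable) x)

  coefficient≢0 : d ≢ 0ℚ
  coefficient≢0 = d≢0 root u v unit

  discriminant≢0 : discriminant (fromℤ a₄) b c d ≢ 0ℚ
  discriminant≢0 = disc≢0 root u v unit (a₄≢0 ∘ fromℤ-injective)

  -- For x ≠ 0 this is x⁴ f(r + 1/x).
  reversed : ℚ → ℚ
  reversed x = fromℤ a₄ ℚ.+ x ℚ.* (b ℚ.+ x ℚ.* (c ℚ.+ x ℚ.* d))

  -- x = 0 corresponds to the points at infinity of D y² = f(x), which are
  -- rational only if D is the squarefree part of a₄.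
  reversed-value⇒𝒮 : ∀ {D} → Squarefree D → ∣ a₄ ∣ < ∣ D ∣ → ∀ x {t} → t ≢ 0ℚ →
    reversed x ≡ fromℤ D ℚ.* (t ℚ.* t) → 𝒮 f D
  reversed-value⇒𝒮 {D} sf a₄<D x {t} t≢0 value with x ℚ.≟ 0ℚ
  ... | yes refl = contradiction a₄<D (≤⇒≯ (squarefreePart≤ a₄≢0 (sf , t , trans (sym reversed-0) value)))
    where
    reversed-0 : reversed 0ℚ ≡ fromℤ a₄
    reversed-0 = trans (cong (fromℤ a₄ ℚ.+_) (ℚ.*-zeroˡ (b ℚ.+ 0ℚ ℚ.* (c ℚ.+ 0ℚ ℚ.* d))))
      (ℚ.+-identityʳ (fromℤ a₄))
  -- With w = 1/x, f(r + w) = w⁴ D t² = D (w² t)².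
  ... | no x≢0 = r ℚ.+ w , (λ eq → D≢0 (trans (sym f-value) eq)) , sf , w ℚ.* w ℚ.* t , f-value
    where
    open ≡-Reasoning
    w : ℚ
    w = proj₁ (inverse x≢0)
    wx≡1 : w ℚ.* x ≡ 1ℚ
    wx≡1 = proj₂ (inverse x≢0)
    w≢0 : w ≢ 0ℚ
    w≢0 w≡0 = contradiction (trans (sym wx≡1) (trans (cong (ℚ._* x) w≡0) (ℚ.*-zeroˡ x))) λ ()
    f-value : ⟦ f ⟧ (r ℚ.+ w) ≡ fromℤ D ℚ.* ((w ℚ.* w ℚ.* t) ℚ.* (w ℚ.* w ℚ.* t))
    f-value = begin
      ⟦ f ⟧ (r ℚ.+ w)                                     ≡⟨ shift root w ⟩
      w ℚ.* cubic (fromℤ a₄) b c d w                      ≡⟨ reverse-cubic (fromℤ a₄) b c d w x wx≡1 ⟩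
      (w ℚ.* w) ℚ.* (w ℚ.* w) ℚ.* reversed x              ≡⟨ cong ((w ℚ.* w) ℚ.* (w ℚ.* w) ℚ.*_) value ⟩
      (w ℚ.* w) ℚ.* (w ℚ.* w) ℚ.* (fromℤ D ℚ.* (t ℚ.* t)) ≡⟨ e (fromℤ D) w t ⟩
      fromℤ D ℚ.* ((w ℚ.* w ℚ.* t) ℚ.* (w ℚ.* w ℚ.* t))   ∎
      where
      e : ∀ D w t → (w ℚ.* w) ℚ.* (w ℚ.* w) ℚ.* (D ℚ.* (t ℚ.* t)) ≡ D ℚ.* ((w ℚ.* w ℚ.* t) ℚ.* (w ℚ.* w ℚ.* t))
      e = ℚ-Solver.solve-∀ ℚ-ring
    D≢0 : fromℤ D ℚ.* ((w ℚ.* w ℚ.* t) ℚ.* (w ℚ.* w ℚ.* t)) ≢ 0ℚ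
    D≢0 = *-≢0 (λ D≡0 → contradiction (subst (∣ a₄ ∣ <_) (cong ∣_∣ (fromℤ-injective D≡0)) a₄<D) λ ())
               (*-≢0 wwt≢0 wwt≢0)
      where wwt≢0 = *-≢0 (*-≢0 w≢0 w≢0) t≢0

  twist-rank⇒𝒮 : ∀ δ e {r} (e≢0 : fromℤ e ≢ 0ℚ) → Squarefree (δ ℤ.* e) → ∣ a₄ ∣ < ∣ δ ℤ.* e ∣ →
    Twist.HasRank (reversedCurve (fromℤ e) (fromℤ a₄) b c d e≢0 coefficient≢0 discriminant≢0) δ (suc r) →
    𝒮 f (δ ℤ.* e)
  twist-rank⇒𝒮 δ e e≢0 sf a₄<δe rank =
    let x , t , t≢0 , value = twist-value (fromℤ a₄) b c d e e≢0 coefficient≢0 discriminant≢0 δ rank in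
    reversed-value⇒𝒮 sf a₄<δe x t≢0 value

  module _ (parity : ParityConjecture) {m : ℤ} {p : ℕ} .{{_ : NonZero p}}
    (d₁ : ℕ) .{{_ : NonZero d₁}} (sf₁ : Squarefree (+ d₁)) (a₄<d₁ : ∣ a₄ ∣ < d₁)
    (d₁≡m : + d₁ ≡ m [mod p ]) where

    private
      d₁≢0 : fromℤ (+ d₁) ≢ 0ℚ
      d₁≢0 = ≢-nonZero⁻¹ d₁ ∘ ℤ.+-injective ∘ fromℤ-injective

      E : EllipticCurve
      E = reversedCurve (fromℤ (+ d₁)) (fromℤ a₄) b c d d₁≢0 coefficient≢0 discriminant≢0

    large-element : ∃ (Twist.HasRank E 1ℤ) → ∃ λ D → (𝒮 f D × D ≡ m [mod p ]) × d₁ ≤ ∣ D ∣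
    large-element (suc r , rank) = + d₁ , (d₁∈𝒮 , d₁≡m) , ≤-refl
      where
      d₁∈𝒮 : 𝒮 f (+ d₁)
      d₁∈𝒮 = subst (λ D → Squarefree D → ∣ a₄ ∣ < ∣ D ∣ → 𝒮 f D) (ℤ.*-identityˡ (+ d₁))
        (λ sf a₄<D → twist-rank⇒𝒮 1ℤ (+ d₁) d₁≢0 sf a₄<D rank) sf₁ a₄<d₁
    large-element (zero , rank-0) =
      D , (twist-rank⇒𝒮 d₂ (+ d₁) d₁≢0 sf-D (<-≤-trans a₄<d₁ d₁≤D) (proj₂ rank) , D≡m) , d₁≤D
      where
      N : ℕ
      N = conductor E
      instance
        N≢0 : NonZero N
        N≢0 = conductor-nonZero E
        8N≢0 : NonZero (8 * N)
        8N≢0 = m*n≢0 8 N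
        d₁p≢0 : NonZero (d₁ * p)
        d₁p≢0 = m*n≢0 d₁ p
      -- The factor 8N determines the character, d₁ makes d₂ coprime to d₁ so that the product is
      -- squarefree, and p keeps the product congruent to m.
      progression : ∃ λ n → 8 * N * (d₁ * p) ∣ 2 + n × Squarefree (+ suc n)
      progression = squarefree≡-1 (8 * N * (d₁ * p)) {{m*n≢0 (8 * N) (d₁ * p)}}
      n : ℕ
      n = proj₁ progression
      d₂ D : ℤ
      d₂ = -[1+ n ]
      D = d₂ ℤ.* + d₁
      M∣2+n : 8 * N * (d₁ * p) ∣ 2 + n
      M∣2+n = proj₁ (proj₂ progression)
      sf₂ : Squarefree d₂
      sf₂ = proj₂ (proj₂ progression)
      d₁p∣2+n : d₁ * p ∣ 2 + n
      d₁p∣2+n = ∣-trans (n∣m*n (8 * N)) M∣2+n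
      rank : ∃ λ r → Twist.HasRank E d₂ (suc r)
      rank = odd-twist E parity rank-0 n sf₂ (∣-trans (m∣m*n (d₁ * p)) M∣2+n)
      sf-D : Squarefree D
      sf-D = squarefree-* d₂ (+ d₁) (coprime-∣ʳ (∣-trans (m∣m*n p) d₁p∣2+n) (suc-coprime (suc n))) sf₂ sf₁
      d₁≤D : d₁ ≤ ∣ D ∣
      d₁≤D = subst (d₁ ≤_) (sym (ℤ.abs-* d₂ (+ d₁))) (m≤n*m d₁ (suc n))
      D≡m : D ≡ m [mod p ]
      -- As d₂ = 1 - (2 + n), the difference D - m is (d₁ - m) - (2 + n) d₁.
      D≡m = Signed.∣⇒∣ᵤ {+ p} {D ℤ.- m} (subst (+ p Signed.∣_) (e n (+ d₁) m)
        (Signed.∣m∣n⇒∣m-n (Signed.∣ᵤ⇒∣ {+ p} {+ d₁ ℤ.- m} d₁≡m)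
          (Signed.∣m⇒∣m*n (+ d₁) (Signed.∣ᵤ⇒∣ {+ p} {+ (2 + n)} (∣-trans (n∣m*n d₁) d₁p∣2+n)))))
        where
        e : ∀ n d₁ m → (d₁ ℤ.- m) ℤ.- + (2 + n) ℤ.* d₁ ≡ -[1+ n ] ℤ.* d₁ ℤ.- m
        e n d₁ m = ring (+ suc n) d₁ m
          where
          ring : ∀ k d₁ m → (d₁ ℤ.- m) ℤ.- (1ℤ ℤ.+ k) ℤ.* d₁ ≡ (ℤ.- k) ℤ.* d₁ ℤ.- m
          ring = ℤ-Solver.solve-∀

  infinite : ParityConjecture → ∀ {m p} .{{_ : NonZero p}} → ℤ.Coprime m (+ p) →
    Infinite (λ D → 𝒮 f D × D ≡ m [mod p ])
  infinite parity {m} {p} m⊥p xs =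
    -- The first summand rules out the points at infinity; the second bounds every entry of `xs`, so
    -- D, being larger in absolute value, is not among them.
    let K = ∣ a₄ ∣ + sum (List.map ∣_∣ xs)
        d₁ , K<d₁ , sf , d₁≡m = squarefree≡ {m} {p} m⊥p K
        instance d₁≢0 = >-nonZero (≤-<-trans z≤n K<d₁)
        D , D∈ , d₁≤D = large-element parity {m} {p} d₁ sf (≤-<-trans (m≤m+n ∣ a₄ ∣ _) K<d₁) d₁≡m
                          (rank-exists _ parity)
    in D , D∈ , λ D∈xs → contradiction (≤-trans (∣∈∣≤sum D∈xs) (m≤n+m _ ∣ a₄ ∣)) (<⇒≱ (<-≤-trans K<d₁ d₁≤D))

proposition3p10 : ParityConjecture →
    (f : Polynomial 4) → Separable f → (∃ λ r → ⟦ f ⟧ r ≡ 0ℚ) →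
    (p : ℕ) → Good p f →
    (m : ℤ) → Coprime m (+ p) →
    Infinite (λ d → 𝒮 f d × d ≡ m [mod p ])
proposition3p10 parity record { coeffs = a₀ ∷ a₁ ∷ a₂ ∷ a₃ ∷ a₄ ∷ [] ; leading≢0 = a₄≢0 }
  separable (r , root) p (p-prime , _) m m⊥p =
  QuarticWithRoot.infinite a₀ a₁ a₂ a₃ a₄ a₄≢0 separable r root parity {{prime⇒nonZero p-prime}} m⊥p
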